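{- Let $H$ be a connected graph and $G=L(H)$. Then $G$ is localizable if and only if one of the following holds: (1) $H$ is not isomorphic to any of $K_3$, $K_4$, the diamond, and the pendant reduction $F$ of $H$ is a connected bipartite graph with a bipartition of $V(F)$ into independent sets $U$ and $W$ such that (a) $R_{\diamond}(H)\cup R_{K_4}(H)\subseteq U$, (b) $R_{\triangle}(H)\subseteq W$, and (c) every vertex $u\in U\setminus R_{K_4}(H)$ is strong in the graph $F-(N_F(u)\cap R_{\triangle}(H))$; (2) $H$ is isomorphic to $K_3$ or to $K_4$.
   Context: $L(H)$ is the line graph of $H$. A clique is strong if it intersects every maximal independent set; a graph is localizable if its vertex set admits a partition into strong cliques. A vertex $v$ of a graph is strong if every maximal matching of that graph covers $v$. The diamond is the graph with vertices $a,b,c,d$ and edges $ab,ac,bc,bd,cd$, with tips $a,d$. Let $d_H$ denote degree in $H$. For a triangle with vertices $a,b,c$ in $H$: it is a pendant triangle if $d_H(a)=d_H(b)=2<d_H(c)$, with root $c$; a pendant diamond is a set of vertices $a,b,c,d$ of $H$ inducing a diamond with tips $a,d$ such that $d_H(a)=2$ and $d_H(b)=d_H(c)=3\le d_H(d)$, with root $d$; a pendant $K_4$ is a set of vertices $a,b,c,d$ inducing $K_4$ with $d_H(a)=d_H(b)=d_H(c)=3<d_H(d)$, with root $d$. These are the pendant subgraphs of $H$. $R_{\triangle}(H)$, $R_{\diamond}(H)$, $R_{K_4}(H)$ denote the sets of roots of all pendant triangles, pendant diamonds, and pendant $K_4$s of $H$, respectively. The pendant reduction of $H$ is the graph obtained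 from $H$ by deleting all non-root vertices of all its pendant subgraphs. $N_F(u)$ is the neighborhood of $u$ in $F$. -}

module Defs where

open import Data.Nat.Base using (ℕ; _*_; _≤_; _<_)
import Data.Nat.Properties as ℕ
open import Data.Fin.Base using (Fin; quotient; remainder)
open import Data.Fin.Patterns using (0F; 1F; 2F; 3F)
open import Data.Fin.Properties using (_≟_; _<?_; any?; all?)
open import Data.Fin.Subset
open import Data.Fin.Subset.Properties
open import Data.Product using (_×_; _,_; proj₁; proj₂; ∃-syntax; ∃!)
open import Data.Sum using (_⊎_)
open import Data.Vec.Base using (tabulate)
open import Data.Vec.Properties
  using (lookup∘tabulate; []=⇒lookup; lookup⇒[]=)
open import Function.Base using (_∘_)
open import Function.Bundles using (_⇔_; _↔_; Inverse)
open import Relation.Binary.Construct.Closure.ReflexiveTransitive using (Star)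
open import Relation.Binary.PropositionalEquality
  using (_≡_; _≢_; refl; sym; trans; subst)
open import Relation.Nullary using (¬_; Dec; yes; no; does)
open import Relation.Nullary.Decidable using (¬?; _×-dec_; _⊎-dec_; _→-dec_; dec-true; from-yes)
open import Relation.Unary using (Pred; Decidable)
open import Level using (0ℓ)

sep : ∀ {n} {P : Pred (Fin n) 0ℓ} → Decidable P → Subset n
sep P? = tabulate (λ x → does (P? x))

∈-sep⁺ : ∀ {n} {P : Pred (Fin n) 0ℓ} (P? : Decidable P) {x} → P x → x ∈ sep P?
∈-sep⁺ P? {x} px =
  lookup⇒[]= x _ (trans (lookup∘tabulate _ x) (dec-true (P? x) px))

∈-sep⁻ : ∀ {n} {P : Pred (Fin n) 0ℓ} (P? : Decidable P) {x} → x ∈ sep P? → P x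
∈-sep⁻ P? {x} x∈ with P? x | trans (sym (lookup∘tabulate (does ∘ P?) x)) ([]=⇒lookup x∈)
... | yes px | _  = px
... | no  _  | ()

-- Finite simple graphs.  The vertices are drawn from Fin n but need not
-- exhaust it, so that induced subgraphs keep the names of their vertices.
record Graph (n : ℕ) : Set where
  field
    V        : Subset n
    N        : Fin n → Subset n
    N⊆V      : ∀ {u} → N u ⊆ V
    N-sym    : ∀ {u v} → v ∈ N u → u ∈ N v
    N-irrefl : ∀ {u} → u ∉ N u

open Graph public

module _ {n : ℕ} (G : Graph n) where

  Adj : Fin n → Fin n → Set
  Adj u v = v ∈ N G u

  adj? : ∀ u v → Dec (Adj u v)
  adj? u v = v ∈? N G u

  deg : Fin n → ℕ
  deg u = ∣ N G u ∣

  Connected : Set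
  Connected = Nonempty (V G) × (∀ {u v} → u ∈ V G → v ∈ V G → Star Adj u v)

  IsIndependent : Subset n → Set
  IsIndependent S = S ⊆ V G × (∀ {u v} → u ∈ S → v ∈ S → ¬ Adj u v)

  IsMaximalIndependent : Subset n → Set
  IsMaximalIndependent S =
    IsIndependent S × (∀ {T} → IsIndependent T → S ⊆ T → T ⊆ S)

  IsClique : Subset n → Set
  IsClique C = C ⊆ V G × (∀ {u v} → u ∈ C → v ∈ C → u ≢ v → Adj u v)

  IsStrongClique : Subset n → Set
  IsStrongClique C =
    IsClique C × (∀ {I} → IsMaximalIndependent I → Nonempty (C ∩ I))

  -- The parts are the sets C i; they cover V G because every vertex lies in
  -- some C i, and are disjoint because that i is unique.
  IsPartition : ∀ {k} → (Fin k → Subset n) → Set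
  IsPartition C =
    (∀ i → Nonempty (C i) × C i ⊆ V G) × (∀ {v} → v ∈ V G → ∃! _≡_ λ i → v ∈ C i)

  Localizable : Set
  Localizable =
    ∃[ k ] ∃[ C ] IsPartition {k} C × (∀ i → IsStrongClique (C i))

  record IsBipartition (U W : Subset n) : Set where
    field
      cover    : U ∪ W ≡ V G
      disjoint : Empty (U ∩ W)
      indepU   : IsIndependent U
      indepW   : IsIndependent W

  Vertex : Set
  Vertex = ∃[ v ] v ∈ V G

record _≅_ {m n} (G : Graph m) (H : Graph n) : Set where
  field
    bij : Vertex G ↔ Vertex H
  open Inverse bij public using (to; from)
  field
    pres : ∀ x y → Adj G (proj₁ x) (proj₁ y) ⇔ Adj H (proj₁ (to x)) (proj₁ (to y))

inducedAdj? : ∀ {n} (G : Graph n) (S : Subset n) (u : Fin n) →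
  Decidable (λ v → u ∈ S × v ∈ S × Adj G u v)
inducedAdj? G S u v = (u ∈? S) ×-dec (v ∈? S) ×-dec adj? G u v

induced : ∀ {n} → Graph n → Subset n → Graph n
induced G S = record
  { V        = V G ∩ S
  ; N        = λ u → sep (inducedAdj? G S u)
  ; N⊆V      = λ {u} v∈ → let (_ , v∈S , a) = ∈-sep⁻ (inducedAdj? G S u) v∈
                          in x∈p∩q⁺ (N⊆V G a , v∈S)
  ; N-sym    = λ {u} {v} v∈ → let (u∈S , v∈S , a) = ∈-sep⁻ (inducedAdj? G S u) v∈
                              in ∈-sep⁺ (inducedAdj? G S v) (v∈S , u∈S , N-sym G a)
  ; N-irrefl = λ {u} u∈ → N-irrefl G (proj₂ (proj₂ (∈-sep⁻ (inducedAdj? G S u) u∈)))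
  }

_∖_ : ∀ {n} → Graph n → Subset n → Graph n
G ∖ X = induced G (∁ X)

-- Edges.  An edge {i , j} with i < j is encoded as the element
-- combine i j of Fin (n * n), whose two ends are recovered by quotient
-- and remainder.
module _ {n : ℕ} where

  end₁ end₂ : Fin (n * n) → Fin n
  end₁ = quotient {n} n
  end₂ = remainder {n} n

  Incident : Fin n → Fin (n * n) → Set
  Incident v e = v ≡ end₁ e ⊎ v ≡ end₂ e

  incident? : ∀ v e → Dec (Incident v e)
  incident? v e = (v ≟ end₁ e) ⊎-dec (v ≟ end₂ e)

  module _ (G : Graph n) where

    E : Subset (n * n)
    E = sep (λ e → (end₁ e <? end₂ e) ×-dec adj? G (end₁ e) (end₂ e))

    IsMatching : Subset (n * n) → Set
    IsMatching M =
      M ⊆ E × (∀ {e f v} → e ∈ M → f ∈ M → Incident v e → Incident v f → e ≡ f)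

    IsMaximalMatching : Subset (n * n) → Set
    IsMaximalMatching M = IsMatching M × (∀ {M′} → IsMatching M′ → M ⊆ M′ → M′ ⊆ M)

    Covers : Subset (n * n) → Fin n → Set
    Covers M v = ∃[ e ] e ∈ M × Incident v e

    IsStrongVertex : Fin n → Set
    IsStrongVertex v = v ∈ V G × (∀ {M} → IsMaximalMatching M → Covers M v)

    lineAdj? : (e : Fin (n * n)) →
      Decidable (λ f → e ∈ E × f ∈ E × e ≢ f × ∃[ v ] Incident v e × Incident v f)
    lineAdj? e f = (e ∈? E) ×-dec (f ∈? E) ×-dec ¬? (e ≟ f)
      ×-dec any? (λ v → incident? v e ×-dec incident? v f)

    L : Graph (n * n)
    L = record
      { V        = E
      ; N        = λ e → sep (lineAdj? e)
      ; N⊆V      = λ {e} f∈ → proj₁ (proj₂ (∈-sep⁻ (lineAdj? e) f∈))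
      ; N-sym    = λ {e} {f} f∈ →
          let (e∈E , f∈E , e≢f , v , ve , vf) = ∈-sep⁻ (lineAdj? e) f∈
          in ∈-sep⁺ (lineAdj? f) (f∈E , e∈E , e≢f ∘ sym , v , vf , ve)
      ; N-irrefl = λ {e} e∈ → proj₁ (proj₂ (proj₂ (∈-sep⁻ (lineAdj? e) e∈))) refl
      }

K : (n : ℕ) → Graph n
K n = record
  { V        = ⊤
  ; N        = λ u → ∁ ⁅ u ⁆
  ; N⊆V      = λ _ → ∈⊤
  ; N-sym    = λ {u} {v} v∈ → x∉p⇒x∈∁p (λ u∈ →
      x∈∁p⇒x∉p v∈ (subst (_∈ ⁅ u ⁆) (x∈⁅y⁆⇒x≡y v u∈) (x∈⁅x⁆ u)))
  ; N-irrefl = λ {u} u∈ → x∈∁p⇒x∉p u∈ (x∈⁅x⁆ u)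
  }

-- The vertices a, b, c, d are 0, 1, 2, 3.
Diamond : Graph 4
Diamond = record
  { V        = ⊤
  ; N        = nbr
  ; N⊆V      = λ _ → ∈⊤
  ; N-sym    = λ {u} {v} → from-yes (all? λ u → all? λ v → v ∈? nbr u →-dec u ∈? nbr v) u v
  ; N-irrefl = λ {u} → from-yes (all? λ u → ¬? (u ∈? nbr u)) u
  }
  where
  nbr : Fin 4 → Subset 4
  nbr 0F = ⁅ 1F ⁆ ∪ ⁅ 2F ⁆
  nbr 1F = ⁅ 0F ⁆ ∪ ⁅ 2F ⁆ ∪ ⁅ 3F ⁆
  nbr 2F = ⁅ 0F ⁆ ∪ ⁅ 1F ⁆ ∪ ⁅ 3F ⁆
  nbr 3F = ⁅ 1F ⁆ ∪ ⁅ 2F ⁆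

-- In the predicates Pendant… the root is the last argument.
module _ {n : ℕ} (H : Graph n) where

  -- Adjacency makes the vertices distinct, except for the non-adjacent tips
  -- of a diamond.
  IsTriangle : (a b c : Fin n) → Set
  IsTriangle a b c = Adj H a b × Adj H a c × Adj H b c

  InducesDiamond : (a b c d : Fin n) → Set
  InducesDiamond a b c d =
    Adj H a b × Adj H a c × Adj H b c × Adj H b d × Adj H c d × a ≢ d × ¬ Adj H a d

  InducesK₄ : (a b c d : Fin n) → Set
  InducesK₄ a b c d =
    Adj H a b × Adj H a c × Adj H a d × Adj H b c × Adj H b d × Adj H c d

  PendantTriangle : (a b c : Fin n) → Set
  PendantTriangle a b c =
    IsTriangle a b c × deg H a ≡ 2 × deg H b ≡ 2 × 2 < deg H c

  PendantDiamond : (a b c d : Fin n) → Set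
  PendantDiamond a b c d =
    InducesDiamond a b c d × deg H a ≡ 2 × deg H b ≡ 3 × deg H c ≡ 3 × 3 ≤ deg H d

  PendantK₄ : (a b c d : Fin n) → Set
  PendantK₄ a b c d =
    InducesK₄ a b c d × deg H a ≡ 3 × deg H b ≡ 3 × deg H c ≡ 3 × 3 < deg H d

  pendantTriangle? : ∀ a b c → Dec (PendantTriangle a b c)
  pendantTriangle? a b c =
    (adj? H a b ×-dec adj? H a c ×-dec adj? H b c)
    ×-dec (deg H a ℕ.≟ 2) ×-dec (deg H b ℕ.≟ 2) ×-dec (2 ℕ.<? deg H c)

  pendantDiamond? : ∀ a b c d → Dec (PendantDiamond a b c d)
  pendantDiamond? a b c d =
    (adj? H a b ×-dec adj? H a c ×-dec adj? H b c ×-dec adj? H b d ×-dec adj? H c d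
      ×-dec ¬? (a ≟ d) ×-dec ¬? (adj? H a d))
    ×-dec (deg H a ℕ.≟ 2) ×-dec (deg H b ℕ.≟ 3) ×-dec (deg H c ℕ.≟ 3)
    ×-dec (3 ℕ.≤? deg H d)

  pendantK₄? : ∀ a b c d → Dec (PendantK₄ a b c d)
  pendantK₄? a b c d =
    (adj? H a b ×-dec adj? H a c ×-dec adj? H a d
      ×-dec adj? H b c ×-dec adj? H b d ×-dec adj? H c d)
    ×-dec (deg H a ℕ.≟ 3) ×-dec (deg H b ℕ.≟ 3) ×-dec (deg H c ℕ.≟ 3)
    ×-dec (3 ℕ.<? deg H d)

  R△ R◇ RK₄ : Subset n
  R△  = sep λ c → any? λ a → any? λ b → pendantTriangle? a b c
  R◇  = sep λ d → any? λ a → any? λ b → any? λ c → pendantDiamond? a b c d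
  RK₄ = sep λ d → any? λ a → any? λ b → any? λ c → pendantK₄? a b c d

  NonRoot : Fin n → Set
  NonRoot x =
      (∃[ a ] ∃[ b ] ∃[ c ] PendantTriangle a b c × (x ≡ a ⊎ x ≡ b))
    ⊎ (∃[ a ] ∃[ b ] ∃[ c ] ∃[ d ] PendantDiamond a b c d × (x ≡ a ⊎ x ≡ b ⊎ x ≡ c))
    ⊎ (∃[ a ] ∃[ b ] ∃[ c ] ∃[ d ] PendantK₄ a b c d × (x ≡ a ⊎ x ≡ b ⊎ x ≡ c))

  nonRoot? : Decidable NonRoot
  nonRoot? x =
    (any? λ a → any? λ b → any? λ c →
      pendantTriangle? a b c ×-dec ((x ≟ a) ⊎-dec (x ≟ b)))
    ⊎-dec (any? λ a → any? λ b → any? λ c → any? λ d →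
      pendantDiamond? a b c d ×-dec ((x ≟ a) ⊎-dec (x ≟ b) ⊎-dec (x ≟ c)))
    ⊎-dec (any? λ a → any? λ b → any? λ c → any? λ d →
      pendantK₄? a b c d ×-dec ((x ≟ a) ⊎-dec (x ≟ b) ⊎-dec (x ≟ c)))

  pendantReduction : Graph n
  pendantReduction = H ∖ sep nonRoot?

-- A strong clique of L(H) is either the full star of a strong vertex of H or
-- the edge set of a triangle no two of whose vertices can be matched to
-- different vertices outside it.  Hence L(H) is localizable iff E(H) splits
-- into the stars at an independent set S of strong vertices and such triangles.
-- Apart from H = K₃, K₄ or the diamond, the triangles in question are the
-- pendant triangles and the triangles formed by the non-root vertices of a
-- pendant diamond or K₄.  So every edge of the pendant reduction F belongs to
-- exactly one star, and S ∩ V(F) and its complement form the bipartition.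

module Submission where

open import Defs
open import Data.Nat.Base using (ℕ; zero; suc; _*_; _≤_; _<_; z≤n; s≤s)
import Data.Nat.Properties as ℕ
open import Data.Fin.Base using (Fin; zero; suc; toℕ; combine) renaming (_<_ to _<ᶠ_)
open import Data.Fin.Patterns using (0F; 1F; 2F; 3F)
open import Data.Fin.Properties
  using (_≟_; _<?_; any?; all?; <-cmp; remQuot-combine; combine-remQuot)
open import Data.Fin.Subset
open import Data.Fin.Subset.Induction using (⊃-wellFounded)
open import Data.Fin.Subset.Properties
open import Data.Empty using () renaming (⊥ to ⊥ᵗ)
open import Data.List.Base using (List; []; _∷_; length; foldr; lookup; allFin)
import Data.List.Membership.DecPropositional as DecMembership
open import Data.List.Membership.Propositional using () renaming (_∈_ to _∈ˡ_; _∉_ to _∉ˡ_)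
open import Data.List.Membership.Propositional.Properties using (∈-lookup; ∈-allFin)
open import Data.List.Relation.Binary.Permutation.Propositional
  using (_↭_; ↭-refl; ↭-sym; ↭-trans; prep; swap)
open import Data.List.Relation.Binary.Permutation.Propositional.Properties using (∈-resp-↭)
import Data.List.Relation.Unary.All as All
open import Data.List.Relation.Unary.All using () renaming ([] to []ᵃ; _∷_ to _∷ᵃ_)
open import Data.List.Relation.Unary.All.Properties using (¬Any⇒All¬)
open import Data.List.Relation.Unary.AllPairs using (AllPairs; []; _∷_)
import Data.List.Relation.Unary.Any as Any
open import Data.List.Relation.Unary.Any using (Any; here; there)
open import Data.List.Relation.Unary.Any.Properties using (lookup-index)
open import Data.List.Relation.Unary.Unique.Propositional using (Unique)
open import Data.Product using (_×_; _,_; proj₁; proj₂; ∃-syntax; ∃!)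
open import Data.Sum using (_⊎_; inj₁; inj₂; [_,_]′)
import Data.Vec.Base as Vec
open import Data.Vec.Base using (_∷_)
open import Data.Vec.Properties.WithK using ([]=-irrelevant)
open import Function.Base using (_∘_; id; case_of_)
open import Function.Bundles using (_⇔_; mk⇔; mk↔ₛ′; Equivalence; Inverse)
open import Induction.WellFounded using (Acc; acc)
open import Relation.Binary.Construct.Closure.ReflexiveTransitive using (Star; ε; _◅_)
open import Relation.Binary.Definitions using (tri<; tri≈; tri>)
open import Relation.Binary.PropositionalEquality
  using (_≡_; _≢_; refl; sym; trans; cong; subst; subst₂)
open import Relation.Nullary using (¬_; Dec; yes; no; contradiction)
open import Relation.Nullary.Decidable using (¬?; _×-dec_; _→-dec_; _⊎-dec_; map′; from-yes)

-- Strength speaks of maximal matchings, and maximality is lost on passing to a subgraph or back.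
-- `Forced` replaces it by a condition on all matchings: one that covers every neighbour of u also
-- covers u. In this form strength passes between H and the graph in (c) by discarding or adding
-- edges. This also explains (c). A neighbour of u that is the root of a pendant triangle can be
-- matched to a vertex of degree 2 outside F, and the two neighbours of u in a pendant diamond
-- rooted at u can be matched to each other, so neither helps to cover u. The three non-roots of a
-- pendant K4 cannot be matched among themselves, so its root is strong in H whatever F is. The
-- sides of the roots come from edges outside all strong triangles: those between the root and the
-- non-roots of a pendant diamond or K4 must lie in stars, and two adjacent non-roots cannot both be
-- centres, so the root is one. In the diamond the middle edge alone is a maximal matching that
-- misses both tips, so no tip can be the centre of a star beside the opposite triangle.

private variable
  m n : ℕ

-- Counting with subsets and lists

x∈p─q⇒x∉q : ∀ (p q : Subset n) {x} → x ∈ p ─ q → x ∉ q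
x∈p─q⇒x∉q (inside  ∷ p) (inside ∷ q) () Vec.here
x∈p─q⇒x∉q (outside ∷ p) (inside ∷ q) () Vec.here
x∈p─q⇒x∉q (_ ∷ p) (_ ∷ q) (Vec.there x∈) (Vec.there x∈q) = x∈p─q⇒x∉q p q x∈ x∈q

∣⁅x⁆∪p∣≤1+∣p∣ : (x : Fin n) (p : Subset n) → ∣ ⁅ x ⁆ ∪ p ∣ ≤ suc ∣ p ∣
∣⁅x⁆∪p∣≤1+∣p∣ zero    (inside  ∷ p) rewrite ∪-identityˡ p = ℕ.n≤1+n _
∣⁅x⁆∪p∣≤1+∣p∣ zero    (outside ∷ p) rewrite ∪-identityˡ p = ℕ.≤-refl
∣⁅x⁆∪p∣≤1+∣p∣ (suc x) (inside  ∷ p) = s≤s (∣⁅x⁆∪p∣≤1+∣p∣ x p)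
∣⁅x⁆∪p∣≤1+∣p∣ (suc x) (outside ∷ p) = ∣⁅x⁆∪p∣≤1+∣p∣ x p

fromList : List (Fin n) → Subset n
fromList = foldr (λ x → ⁅ x ⁆ ∪_) ⊥

∈-fromList⁺ : {xs : List (Fin n)} {x : Fin n} → x ∈ˡ xs → x ∈ fromList xs
∈-fromList⁺ (here refl) = x∈p∪q⁺ (inj₁ (x∈⁅x⁆ _))
∈-fromList⁺ (there x∈)  = x∈p∪q⁺ (inj₂ (∈-fromList⁺ x∈))

∣fromList∣≤length : (xs : List (Fin n)) → ∣ fromList xs ∣ ≤ length xs
∣fromList∣≤length {n} []  = ℕ.≤-reflexive (∣⊥∣≡0 n)
∣fromList∣≤length (x ∷ xs) =
  ℕ.≤-trans (∣⁅x⁆∪p∣≤1+∣p∣ x (fromList xs)) (s≤s (∣fromList∣≤length xs))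

module _ {n : ℕ} where
  open DecMembership (_≟_ {n}) public using () renaming (_∈?_ to _∈ˡ?_)

length≤∣p∣ : (p : Subset n) {xs : List (Fin n)} → Unique xs →
  (∀ {x} → x ∈ˡ xs → x ∈ p) → length xs ≤ ∣ p ∣
length≤∣p∣ p []           _    = z≤n
length≤∣p∣ p (x∉xs ∷ xs!) xs⊆p = ℕ.≤-trans
  (s≤s (length≤∣p∣ _ xs! λ y∈ →
    x∈p∧x≢y⇒x∈p-y (xs⊆p (there y∈)) (All.lookup x∉xs y∈ ∘ sym)))
  (x∈p⇒∣p-x∣<∣p∣ (xs⊆p (here refl)))

∣p∣≤length : (p : Subset n) (xs : List (Fin n)) →
  (∀ {x} → x ∈ p → x ∈ˡ xs) → ∣ p ∣ ≤ length xs
∣p∣≤length p xs p⊆xs =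
  ℕ.≤-trans (p⊆q⇒∣p∣≤∣q∣ (∈-fromList⁺ ∘ p⊆xs)) (∣fromList∣≤length xs)

module _ (p : Subset n) {xs : List (Fin n)} (xs! : Unique xs) (xs⊆p : ∀ {x} → x ∈ˡ xs → x ∈ p) where

  ∣p∣≡length : (∀ {x} → x ∈ p → x ∈ˡ xs) → ∣ p ∣ ≡ length xs
  ∣p∣≡length p⊆xs = ℕ.≤-antisym (∣p∣≤length p xs p⊆xs) (length≤∣p∣ p xs! xs⊆p)

  ∣p∣≤length⇒p⊆ : ∣ p ∣ ≤ length xs → ∀ {x} → x ∈ p → x ∈ˡ xs
  ∣p∣≤length⇒p⊆ p≤ {x} x∈p with x ∈ˡ? xs
  ... | yes x∈xs = x∈xs
  ... | no  x∉xs = contradiction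
    (ℕ.≤-trans (length≤∣p∣ p (All.tabulate (λ y∈ x≡y → x∉xs (subst (_∈ˡ xs) (sym x≡y) y∈)) ∷ xs!)
      λ { (here refl) → x∈p ; (there y∈) → xs⊆p y∈ }) p≤) ℕ.1+n≰n

length<∣p∣⇒extra : (p : Subset n) (xs : List (Fin n)) → length xs < ∣ p ∣ →
  ∃[ x ] x ∈ p × x ∉ˡ xs
length<∣p∣⇒extra p xs xs<p with any? (λ x → (x ∈? p) ×-dec ¬? (x ∈ˡ? xs))
... | yes extra = extra
... | no ¬extra = contradiction (∣p∣≤length p xs p⊆xs) (ℕ.<⇒≱ xs<p)
  where
  p⊆xs : ∀ {x} → x ∈ p → x ∈ˡ xs
  p⊆xs {x} x∈p with x ∈ˡ? xs
  ... | yes x∈xs = x∈xs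
  ... | no  x∉xs = contradiction (x , x∈p , x∉xs) ¬extra

Unique₂ : {a b : Fin n} → a ≢ b → Unique (a ∷ b ∷ [])
Unique₂ a≢b = (a≢b ∷ᵃ []ᵃ) ∷ []ᵃ ∷ []

Unique₃ : {a b c : Fin n} → a ≢ b → a ≢ c → b ≢ c → Unique (a ∷ b ∷ c ∷ [])
Unique₃ a≢b a≢c b≢c = (a≢b ∷ᵃ a≢c ∷ᵃ []ᵃ) ∷ Unique₂ b≢c

-- Otherwise p, q, r, s would be four distinct elements of a list of length at most 3. Applied to
-- the ends of two edges inside a triangle.
two-pairs-in-triple-meet : {ts : List (Fin n)} → length ts ≤ 3 → ∀ {p q r s} → p ≢ q → r ≢ s →
  p ∈ˡ ts → q ∈ˡ ts → r ∈ˡ ts → s ∈ˡ ts → p ≡ r ⊎ p ≡ s ⊎ q ≡ r ⊎ q ≡ s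
two-pairs-in-triple-meet {ts = ts} ts≤3 {p} {q} {r} {s} p≢q r≢s p∈ q∈ r∈ s∈
  with p ≟ r | p ≟ s | q ≟ r | q ≟ s
... | yes e | _ | _ | _ = inj₁ e
... | _ | yes e | _ | _ = inj₂ (inj₁ e)
... | _ | _ | yes e | _ = inj₂ (inj₂ (inj₁ e))
... | _ | _ | _ | yes e = inj₂ (inj₂ (inj₂ e))
... | no p≢r | no p≢s | no q≢r | no q≢s = contradiction
  (ℕ.≤-trans (length≤∣p∣ (fromList ts)
      ((p≢q ∷ᵃ p≢r ∷ᵃ p≢s ∷ᵃ []ᵃ) ∷ Unique₃ q≢r q≢s r≢s) (∈-fromList⁺ ∘ pqrs⊆ts))
    (ℕ.≤-trans (∣fromList∣≤length ts) ts≤3)) ℕ.1+n≰n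
  where
  pqrs⊆ts : ∀ {x} → x ∈ˡ p ∷ q ∷ r ∷ s ∷ [] → x ∈ˡ ts
  pqrs⊆ts (here refl) = p∈
  pqrs⊆ts (there (here refl)) = q∈
  pqrs⊆ts (there (there (here refl))) = r∈
  pqrs⊆ts (there (there (there (here refl)))) = s∈

-- Edges and matchings

end₁-combine : (u v : Fin n) → end₁ {n} (combine u v) ≡ u
end₁-combine u v = cong proj₁ (remQuot-combine u v)

end₂-combine : (u v : Fin n) → end₂ {n} (combine u v) ≡ v
end₂-combine u v = cong proj₂ (remQuot-combine u v)

opaque
  -- Symmetric in its arguments, whereas `E` only contains pairs with the smaller end first. It is
  -- opaque so that later proofs use the laws of this block and never the comparison of u with v.
  edge : Fin n → Fin n → Fin (n * n)
  edge u v with u <? v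
  ... | yes _ = combine u v
  ... | no  _ = combine v u

  edge-comm : (u v : Fin n) → edge u v ≡ edge v u
  edge-comm u v with u <? v | v <? u | <-cmp u v
  ... | yes u<v | yes v<u | _            = contradiction v<u (ℕ.<-asym u<v)
  ... | yes _   | no _    | _            = refl
  ... | no _    | yes _   | _            = refl
  ... | no u≮v  | no _    | tri< u<v _ _ = contradiction u<v u≮v
  ... | no _    | no _    | tri≈ _ refl _ = refl
  ... | no _    | no v≮u  | tri> _ _ v<u = contradiction v<u v≮u

  incident₁ : (u v : Fin n) → Incident u (edge u v)
  incident₁ u v with u <? v
  ... | yes _ = inj₁ (sym (end₁-combine u v))
  ... | no  _ = inj₂ (sym (end₂-combine v u))

  incident₂ : (u v : Fin n) → Incident v (edge u v)
  incident₂ u v = subst (Incident v) (edge-comm v u) (incident₁ v u)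

  edge≡combine : (u v : Fin n) → u <ᶠ v → edge u v ≡ combine u v
  edge≡combine u v u<v with u <? v
  ... | yes _   = refl
  ... | no  u≮v = contradiction u<v u≮v

  edge-case : (P : Fin (n * n) → Set) (u v : Fin n) →
    (u <ᶠ v → P (combine u v)) → (v <ᶠ u → P (combine v u)) → u ≢ v → P (edge u v)
  edge-case P u v P< P> u≢v with u <? v | <-cmp u v
  ... | yes u<v | _            = P< u<v
  ... | no  u≮v | tri< u<v _ _ = contradiction u<v u≮v
  ... | no  _   | tri≈ _ u≡v _ = contradiction u≡v u≢v
  ... | no  _   | tri> _ _ v<u = P> v<u

  incident⁻ : (u v : Fin n) {w : Fin n} → Incident w (edge u v) → w ≡ u ⊎ w ≡ v
  incident⁻ u v i with u <? v | i
  ... | yes _ | inj₁ w≡ = inj₁ (trans w≡ (end₁-combine u v))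
  ... | yes _ | inj₂ w≡ = inj₂ (trans w≡ (end₂-combine u v))
  ... | no  _ | inj₁ w≡ = inj₂ (trans w≡ (end₁-combine v u))
  ... | no  _ | inj₂ w≡ = inj₁ (trans w≡ (end₂-combine v u))

edge-ends : (e : Fin (n * n)) → end₁ e <ᶠ end₂ {n} e → edge (end₁ {n} e) (end₂ e) ≡ e
edge-ends {n} e lt = trans (edge≡combine _ _ lt) (combine-remQuot {n} n e)

edge-injectiveʳ : {u v w : Fin n} → edge u v ≡ edge u w → v ≡ w
edge-injectiveʳ {u = u} {v} {w} e
  with incident⁻ u w (subst (Incident v) e (incident₂ u v))
     | incident⁻ u v (subst (Incident w) (sym e) (incident₂ u w))
... | inj₂ v≡w | _        = v≡w
... | _        | inj₂ w≡v = sym w≡v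
... | inj₁ v≡u | inj₁ w≡u = trans v≡u (sym w≡u)

module _ (G : Graph n) where

  Adj⇒≢ : ∀ {u v} → Adj G u v → u ≢ v
  Adj⇒≢ a refl = N-irrefl G a

  private
    isEdge? : (e : Fin (n * n)) → Dec _
    isEdge? e = (end₁ {n} e <? end₂ {n} e) ×-dec adj? G (end₁ e) (end₂ e)

  combine∈E : ∀ {u v} → u <ᶠ v → Adj G u v → combine u v ∈ E G
  combine∈E {u} {v} u<v a = ∈-sep⁺ isEdge? isEdge
    where
    isEdge : end₁ {n} (combine u v) <ᶠ end₂ {n} (combine u v)
           × Adj G (end₁ (combine u v)) (end₂ (combine u v))
    isEdge rewrite end₁-combine u v | end₂-combine u v = u<v , a

  edge∈E : ∀ {u v} → Adj G u v → edge u v ∈ E G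
  edge∈E {u} {v} a = edge-case (_∈ E G) u v
    (λ u<v → combine∈E u<v a) (λ v<u → combine∈E v<u (N-sym G a)) (Adj⇒≢ a)

  E⁻ : ∀ {e} → e ∈ E G → end₁ {n} e <ᶠ end₂ {n} e × Adj G (end₁ e) (end₂ e)
  E⁻ = ∈-sep⁻ isEdge?

  E-at : ∀ {e u} → e ∈ E G → Incident u e → ∃[ v ] Adj G u v × e ≡ edge u v
  E-at {e} {u} e∈ i = at (E⁻ e∈) i
    where
    at : end₁ {n} e <ᶠ end₂ {n} e × Adj G (end₁ e) (end₂ e) → Incident u e → ∃[ v ] Adj G u v × e ≡ edge u v
    at (lt , a) (inj₁ refl) = end₂ e , a , sym (edge-ends e lt)
    at (lt , a) (inj₂ refl) = end₁ e , N-sym G a ,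
      trans (sym (edge-ends e lt)) (edge-comm (end₁ e) (end₂ e))

  edge∈E⁻ : ∀ {u v} → edge u v ∈ E G → Adj G u v
  edge∈E⁻ {u} {v} e∈ with E-at e∈ (incident₁ u v)
  ... | w , a , e≡ = subst (Adj G u) (sym (edge-injectiveʳ e≡)) a

  L-adj⁻ : ∀ {e f} → Adj (L G) e f → ∃[ v ] Incident v e × Incident v f
  L-adj⁻ {e} {f} a = proj₂ (proj₂ (proj₂ (∈-sep⁻ (lineAdj? G e) a)))

  covers? : (M : Subset (n * n)) (v : Fin n) → Dec (Covers G M v)
  covers? M v = any? λ e → (e ∈? M) ×-dec incident? v e

  matching-unique : ∀ {M u v w} → IsMatching G M → edge u v ∈ M → edge u w ∈ M → v ≡ w
  matching-unique {u = u} {v} {w} (_ , disj) v∈ w∈ =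
    edge-injectiveʳ (disj v∈ w∈ (incident₁ u v) (incident₁ u w))

  covers-at : ∀ {M u} → M ⊆ E G → Covers G M u → ∃[ v ] Adj G u v × edge u v ∈ M
  covers-at M⊆E (e , e∈M , u∈e) with E-at (M⊆E e∈M) u∈e
  ... | v , a , refl = v , a , e∈M

  singleton-matching : ∀ {e} → e ∈ E G → IsMatching G ⁅ e ⁆
  singleton-matching {e} e∈ =
    (λ f∈ → subst (_∈ E G) (sym (x∈⁅y⁆⇒x≡y e f∈)) e∈) ,
    λ f∈ g∈ _ _ → trans (x∈⁅y⁆⇒x≡y e f∈) (sym (x∈⁅y⁆⇒x≡y e g∈))

  ∪-matching : ∀ {M M′} → IsMatching G M → IsMatching G M′ →
    (∀ {v} → Covers G M v → ¬ Covers G M′ v) → IsMatching G (M ∪ M′)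
  ∪-matching {M} {M′} (M⊆E , M-disj) (M′⊆E , M′-disj) apart = sub , disj
    where
    sub : M ∪ M′ ⊆ E G
    sub e∈ with x∈p∪q⁻ M M′ e∈
    ... | inj₁ e∈M  = M⊆E e∈M
    ... | inj₂ e∈M′ = M′⊆E e∈M′
    disj : ∀ {e f v} → e ∈ M ∪ M′ → f ∈ M ∪ M′ → Incident v e → Incident v f → e ≡ f
    disj e∈ f∈ ve vf with x∈p∪q⁻ M M′ e∈ | x∈p∪q⁻ M M′ f∈
    ... | inj₁ e∈M  | inj₁ f∈M  = M-disj e∈M f∈M ve vf
    ... | inj₁ e∈M  | inj₂ f∈M′ = contradiction (_ , f∈M′ , vf) (apart (_ , e∈M , ve))
    ... | inj₂ e∈M′ | inj₁ f∈M  = contradiction (_ , e∈M′ , ve) (apart (_ , f∈M , vf))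
    ... | inj₂ e∈M′ | inj₂ f∈M′ = M′-disj e∈M′ f∈M′ ve vf

  covers-mono : ∀ {M M′ v} → M ⊆ M′ → Covers G M v → Covers G M′ v
  covers-mono M⊆M′ (e , e∈M , ve) = e , M⊆M′ e∈M , ve

  covers-singleton⁻ : ∀ {u v w} → Covers G ⁅ edge u v ⁆ w → w ≡ u ⊎ w ≡ v
  covers-singleton⁻ {u} {v} {w} (e , e∈ , we) =
    incident⁻ u v (subst (Incident w) (x∈⁅y⁆⇒x≡y _ e∈) we)

  -- Greedy: as long as some edge has both ends uncovered, it is added. This stops because strict
  -- growth of subsets of a finite set is well-founded.
  extend-matching : ∀ {M} → IsMatching G M → ∃[ M⁺ ] IsMaximalMatching G M⁺ × M ⊆ M⁺
  extend-matching {M} = go (⊃-wellFounded M)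
    where
    go : ∀ {M} → Acc _⊃_ M → IsMatching G M → ∃[ M⁺ ] IsMaximalMatching G M⁺ × M ⊆ M⁺
    go {M} (acc rec) mM
      with any? (λ e → (e ∈? E G) ×-dec ¬? (e ∈? M)
                 ×-dec all? λ v → incident? v e →-dec ¬? (covers? M v))
    ... | yes (e , e∈E , e∉M , free) =
      let M⁺ , max , M′⊆M⁺ = go (rec (q⊆p∪q ⁅ e ⁆ M , e , x∈p∪q⁺ (inj₁ (x∈⁅x⁆ e)) , e∉M))
            (∪-matching (singleton-matching e∈E) mM λ (f , f∈ , vf) →
              free _ (subst (Incident _) (x∈⁅y⁆⇒x≡y e f∈) vf))
      in M⁺ , max , M′⊆M⁺ ∘ q⊆p∪q ⁅ e ⁆ M
    ... | no ¬free = M , (mM , maximal) , id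
      where
      maximal : ∀ {M′} → IsMatching G M′ → M ⊆ M′ → M′ ⊆ M
      maximal (M′⊆E , M′-disj) M⊆M′ {e} e∈M′ with e ∈? M
      ... | yes e∈M = e∈M
      ... | no  e∉M = contradiction
        (e , M′⊆E e∈M′ , e∉M , λ v ve (f , f∈M , vf) →
          e∉M (subst (_∈ M) (M′-disj (M⊆M′ f∈M) e∈M′ vf ve) f∈M)) ¬free

  maximal-matching-dominates : ∀ {M u v} → IsMaximalMatching G M → Adj G u v →
    Covers G M u ⊎ Covers G M v
  maximal-matching-dominates {M} {u} {v} (mM , max) a with covers? M u | covers? M v
  ... | yes c | _     = inj₁ c
  ... | _     | yes c = inj₂ c
  ... | no ¬u | no ¬v = contradiction
    (edge u v , max (∪-matching (singleton-matching (edge∈E a)) mM apart) (q⊆p∪q ⁅ edge u v ⁆ M)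
      (x∈p∪q⁺ (inj₁ (x∈⁅x⁆ (edge u v)))) , incident₁ u v) ¬u
    where
    apart : ∀ {w} → Covers G ⁅ edge u v ⁆ w → ¬ Covers G M w
    apart c with covers-singleton⁻ c
    ... | inj₁ refl = ¬u
    ... | inj₂ refl = ¬v

  -- Equivalent to v being strong, but M need not be maximal.
  Forced : Fin n → Set
  Forced v = ∀ {M} → IsMatching G M → (∀ {x} → Adj G v x → Covers G M x) → Covers G M v

  -- In a maximal extension of M some edge vx covers v. Since M already covers x, disjointness in
  -- the extension makes vx the edge of M at x.
  strong⇒forced : ∀ {v} → IsStrongVertex G v → Forced v
  strong⇒forced {v} (_ , strong) mM nbrs with extend-matching mM
  ... | M⁺ , max@((M⁺⊆E , disj) , _) , M⊆M⁺ with covers-at M⁺⊆E (strong max)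
  ... | x , a , vx∈M⁺ with nbrs a
  ... | e , e∈M , xe with disj vx∈M⁺ (M⊆M⁺ e∈M) (incident₂ v x) xe
  ... | refl = edge v x , e∈M , incident₁ v x

  -- A maximal matching that missed v would cover all neighbours of v, since it covers an end of
  -- every edge.
  forced⇒strong : ∀ {v} → v ∈ V G → Forced v → IsStrongVertex G v
  forced⇒strong {v} v∈V forced = v∈V , strong
    where
    strong : ∀ {M} → IsMaximalMatching G M → Covers G M v
    strong {M} max with covers? M v
    ... | yes c = c
    ... | no ¬c = forced (proj₁ max) λ a → case maximal-matching-dominates max a of λ
      { (inj₁ c) → contradiction c ¬c ; (inj₂ c) → c }

  -- The single edge bc is a matching that covers all neighbours of d, so it has to cover d. This
  -- keeps a tip of degree 2 of a diamond from being strong.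
  strong⇒∈edge : ∀ {b c d} → IsStrongVertex G d → Adj G b c →
    (∀ {x} → Adj G d x → x ≡ b ⊎ x ≡ c) → d ≡ b ⊎ d ≡ c
  strong⇒∈edge {b} {c} {d} d-strong bc Nd = covers-singleton⁻
    (strong⇒forced d-strong {⁅ edge b c ⁆} (singleton-matching (edge∈E bc)) nbrs)
    where
    nbrs : ∀ {x} → Adj G d x → Covers G ⁅ edge b c ⁆ x
    nbrs dx with Nd dx
    ... | inj₁ refl = edge b c , x∈⁅x⁆ _ , incident₁ b c
    ... | inj₂ refl = edge b c , x∈⁅x⁆ _ , incident₂ b c

  matching⇒independent : ∀ {M} → IsMatching G M → IsIndependent (L G) M
  matching⇒independent (M⊆E , disj) = M⊆E , λ {e} e∈ f∈ a →
    let v , ve , vf = L-adj⁻ a in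
    N-irrefl (L G) (subst (Adj (L G) e) (sym (disj e∈ f∈ ve vf)) a)

  independent⇒matching : ∀ {M} → IsIndependent (L G) M → IsMatching G M
  independent⇒matching {M} (M⊆E , indep) = M⊆E , disj
    where
    disj : ∀ {e f v} → e ∈ M → f ∈ M → Incident v e → Incident v f → e ≡ f
    disj {e} {f} e∈ f∈ ve vf with e ≟ f
    ... | yes e≡f = e≡f
    ... | no  e≢f = contradiction
      (∈-sep⁺ (lineAdj? G e) (M⊆E e∈ , M⊆E f∈ , e≢f , _ , ve , vf)) (indep e∈ f∈)

  maximalMatching⇒maximalIndependent : ∀ {M} →
    IsMaximalMatching G M → IsMaximalIndependent (L G) M
  maximalMatching⇒maximalIndependent (mM , max) =
    matching⇒independent mM , λ i → max (independent⇒matching i)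

  maximalIndependent⇒maximalMatching : ∀ {M} →
    IsMaximalIndependent (L G) M → IsMaximalMatching G M
  maximalIndependent⇒maximalMatching (iM , max) =
    independent⇒matching iM , λ m → max (matching⇒independent m)

-- Partitions into strong cliques from partial equivalences

AllPairs-lookup : ∀ {A : Set} {R : A → A → Set} {xs : List A} → AllPairs R xs →
  ∀ i j → i ≢ j → R (lookup xs i) (lookup xs j) ⊎ R (lookup xs j) (lookup xs i)
AllPairs-lookup (_ ∷ _)   zero    zero    i≢j = contradiction refl i≢j
AllPairs-lookup (rs ∷ _)  zero    (suc j) _   = inj₁ (All.lookup rs (∈-lookup j))
AllPairs-lookup (rs ∷ _)  (suc i) zero    _   = inj₂ (All.lookup rs (∈-lookup i))
AllPairs-lookup (_ ∷ rss) (suc i) (suc j) i≢j = AllPairs-lookup rss i j (i≢j ∘ cong suc)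

module _ (G : Graph n) (R : Fin n → Fin n → Set) (R? : ∀ u v → Dec (R u v))
  (R-refl : ∀ {u} → u ∈ V G → R u u) (R-sym : ∀ {u v} → R u v → R v u)
  (R-trans : ∀ {u v w} → R u v → R v w → R u w) (R⇒∈V : ∀ {u v} → R u v → v ∈ V G)
  where

  private
    Reps : List (Fin n) → Set
    Reps xs = ∃[ rs ] AllPairs (λ u v → ¬ R u v) rs × (∀ {u} → u ∈ˡ rs → u ∈ V G)
      × (∀ {u} → u ∈ˡ xs → u ∈ V G → Any (λ r → R r u) rs)

    reps : ∀ xs → Reps xs
    reps []       = [] , [] , (λ ()) , λ ()
    reps (x ∷ xs) with reps xs
    ... | rs , apart , rs⊆V , hit with x ∈? V G | Any.any? (λ r → R? r x) rs
    ... | no x∉V | _ = rs , apart , rs⊆V ,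
      λ { (here refl) x∈V → contradiction x∈V x∉V ; (there u∈) → hit u∈ }
    ... | yes _ | yes x-hit = rs , apart , rs⊆V ,
      λ { (here refl) _ → x-hit ; (there u∈) → hit u∈ }
    ... | yes x∈V | no x-new = x ∷ rs , All.map (_∘ R-sym) (¬Any⇒All¬ rs x-new) ∷ apart ,
      (λ { (here refl) → x∈V ; (there u∈) → rs⊆V u∈ }) ,
      λ { (here refl) _ → here (R-refl x∈V) ; (there u∈) u∈V → there (hit u∈ u∈V) }

  -- `IsPartition` wants its parts indexed by some `Fin k`, so the classes are listed through
  -- pairwise unrelated representatives, collected in one pass over all vertices.
  localizable-by-classes : (∀ {u} → u ∈ V G → IsStrongClique G (sep (R? u))) → Localizable G
  localizable-by-classes strong with reps (allFin n)
  ... | rs , apart , rs⊆V , hit =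
    length rs , C , ((λ i → (lookup rs i , ∈-sep⁺ (R? _) (R-refl (rep∈V i))) , R⇒∈V ∘ ∈-sep⁻ (R? _))
    , unique) , strong ∘ rep∈V
    where
    C : Fin (length rs) → Subset n
    C i = sep (R? (lookup rs i))
    rep∈V : ∀ i → lookup rs i ∈ V G
    rep∈V i = rs⊆V (∈-lookup i)
    same : ∀ {v i j} → R (lookup rs i) v → R (lookup rs j) v → i ≡ j
    same {i = i} {j} ri rj with i ≟ j
    ... | yes i≡j = i≡j
    ... | no  i≢j with AllPairs-lookup apart i j i≢j
    ... | inj₁ ¬r = contradiction (R-trans ri (R-sym rj)) ¬r
    ... | inj₂ ¬r = contradiction (R-trans rj (R-sym ri)) ¬r
    unique : ∀ {v} → v ∈ V G → ∃! _≡_ λ i → v ∈ C i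
    unique {v} v∈V with hit (∈-allFin v) v∈V
    ... | r∈ = Any.index r∈ , ∈-sep⁺ (R? _) (lookup-index r∈) ,
      λ v∈ → same (lookup-index r∈) (∈-sep⁻ (R? _) v∈)

-- Strong cliques of a line graph

module _ (G : Graph n) where

  -- For a triangle ts, this says that its edges form a strong clique of L G.
  Squeezed : List (Fin n) → Set
  Squeezed ts = ∀ {p q x y} → p ∈ˡ ts → q ∈ˡ ts → p ≢ q →
    Adj G p x → x ∉ˡ ts → Adj G q y → y ∉ˡ ts → x ≡ y

  MeetsMaximalMatchings : List (Fin n) → Set
  MeetsMaximalMatchings ts = ∀ {M} → IsMaximalMatching G M →
    ∃[ p ] ∃[ q ] p ∈ˡ ts × q ∈ˡ ts × edge p q ∈ M

  edge∈-comm : ∀ {M : Subset (n * n)} {u v : Fin n} → edge u v ∈ M → edge v u ∈ M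
  edge∈-comm {M} {u} {v} = subst (_∈ M) (edge-comm u v)

  -- A maximal matching covers an end of each side of the triangle, hence at least two corners. If
  -- it contained no side, these two corners would be matched to vertices outside the triangle, and
  -- squeezedness would give both the same partner.
  squeezed⇒meets : ∀ {a b c} → IsTriangle G a b c → Squeezed (a ∷ b ∷ c ∷ []) →
    MeetsMaximalMatchings (a ∷ b ∷ c ∷ [])
  squeezed⇒meets {a} {b} {c} (ab , ac , bc) sq {M} max@(mM , _)
    with any? (λ p → any? λ q → (p ∈ˡ? ts) ×-dec (q ∈ˡ? ts) ×-dec (edge p q ∈? M))
    where ts = a ∷ b ∷ c ∷ []
  ... | yes meet = meet
  ... | no ¬meet = contradiction (maximal-matching-dominates G max ab) λ
    { (inj₁ ca) → case maximal-matching-dominates G max bc of λ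
      { (inj₁ cb) → conflict (Adj⇒≢ G ab) 0∈ 1∈ ca cb
      ; (inj₂ cc) → conflict (Adj⇒≢ G ac) 0∈ 2∈ ca cc }
    ; (inj₂ cb) → case maximal-matching-dominates G max ac of λ
      { (inj₁ ca) → conflict (Adj⇒≢ G ab) 0∈ 1∈ ca cb
      ; (inj₂ cc) → conflict (Adj⇒≢ G bc) 1∈ 2∈ cb cc } }
    where
    ts = a ∷ b ∷ c ∷ []
    0∈ : a ∈ˡ ts
    0∈ = here refl
    1∈ : b ∈ˡ ts
    1∈ = there (here refl)
    2∈ : c ∈ˡ ts
    2∈ = there (there (here refl))
    conflict : ∀ {p q} → p ≢ q → p ∈ˡ ts → q ∈ˡ ts → Covers G M p → ¬ Covers G M q
    conflict {p} {q} p≢q p∈ q∈ cp cq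
      with covers-at G (proj₁ mM) cp | covers-at G (proj₁ mM) cq
    ... | x , px , px∈M | y , qy , qy∈M
      with sq p∈ q∈ p≢q px (λ x∈ → ¬meet (p , x , p∈ , x∈ , px∈M))
                        qy (λ y∈ → ¬meet (q , y , q∈ , y∈ , qy∈M))
    ... | refl = p≢q (matching-unique G mM (edge∈-comm px∈M) (edge∈-comm qy∈M))

  -- If x and y differ, then px and qy form a matching. A maximal extension of it would also contain
  -- an edge between two of the at most three listed vertices, and that edge would meet px or qy in
  -- p or q.
  meets⇒squeezed : ∀ {ts} → length ts ≤ 3 → MeetsMaximalMatchings ts → Squeezed ts
  meets⇒squeezed {ts} ts≤3 meets {p} {q} {x} {y} p∈ q∈ p≢q px x∉ qy y∉ with x ≟ y
  ... | yes x≡y = x≡y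
  ... | no  x≢y
    with extend-matching G (∪-matching G (singleton-matching G (edge∈E G px))
                                         (singleton-matching G (edge∈E G qy)) apart)
    where
    apart : ∀ {w} → Covers G ⁅ edge p x ⁆ w → ¬ Covers G ⁅ edge q y ⁆ w
    apart c d with covers-singleton⁻ G c | covers-singleton⁻ G d
    ... | inj₁ refl | inj₁ refl = p≢q refl
    ... | inj₁ refl | inj₂ refl = y∉ p∈
    ... | inj₂ refl | inj₁ refl = x∉ q∈
    ... | inj₂ refl | inj₂ refl = x≢y refl
  ... | M , max@(mM , _) , ⊆M with meets max
  ... | r , s , r∈ , s∈ , rs∈M
    with two-pairs-in-triple-meet ts≤3 p≢q
           (Adj⇒≢ G (edge∈E⁻ G (proj₁ mM rs∈M))) p∈ q∈ r∈ s∈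
  ... | inj₁ refl = contradiction s∈ λ s∈ → x∉ (subst (_∈ˡ ts) (matching-unique G mM rs∈M px∈M) s∈)
    where px∈M = ⊆M (x∈p∪q⁺ (inj₁ (x∈⁅x⁆ _)))
  ... | inj₂ (inj₁ refl) =
    contradiction (subst (_∈ˡ ts) (matching-unique G mM (edge∈-comm rs∈M) px∈M) r∈) x∉
    where px∈M = ⊆M (x∈p∪q⁺ (inj₁ (x∈⁅x⁆ _)))
  ... | inj₂ (inj₂ (inj₁ refl)) =
    contradiction (subst (_∈ˡ ts) (matching-unique G mM rs∈M qy∈M) s∈) y∉
    where qy∈M = ⊆M (x∈p∪q⁺ (inj₂ (x∈⁅x⁆ _)))
  ... | inj₂ (inj₂ (inj₂ refl)) =
    contradiction (subst (_∈ˡ ts) (matching-unique G mM (edge∈-comm rs∈M) qy∈M) r∈) y∉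
    where qy∈M = ⊆M (x∈p∪q⁺ (inj₂ (x∈⁅x⁆ _)))

  Within : Fin (n * n) → List (Fin n) → Set
  Within e ts = end₁ e ∈ˡ ts × end₂ e ∈ˡ ts

  within? : ∀ e ts → Dec (Within e ts)
  within? e ts = (end₁ e ∈ˡ? ts) ×-dec (end₂ e ∈ˡ? ts)

  within⁺ : ∀ {u v ts} → u ∈ˡ ts → v ∈ˡ ts → Within (edge u v) ts
  within⁺ {u} {v} {ts} u∈ v∈ = end∈ (inj₁ refl) , end∈ (inj₂ refl)
    where
    end∈ : ∀ {w} → Incident w (edge u v) → w ∈ˡ ts
    end∈ i with incident⁻ u v i
    ... | inj₁ refl = u∈
    ... | inj₂ refl = v∈

  within⁻ : ∀ {e v ts} → Within e ts → Incident v e → v ∈ˡ ts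
  within⁻ (1∈ , _) (inj₁ refl) = 1∈
  within⁻ (_ , 2∈) (inj₂ refl) = 2∈

  E-two-ends : ∀ {e u v} → e ∈ E G → Incident u e → Incident v e → u ≢ v → e ≡ edge u v × Adj G u v
  E-two-ends e∈ ue ve u≢v with E-at G e∈ ue
  ... | w , a , refl with incident⁻ _ _ ve
  ... | inj₁ refl = contradiction refl u≢v
  ... | inj₂ refl = refl , a

  ends-≢ : ∀ {e} → e ∈ E G → end₁ {n} e ≢ end₂ e
  ends-≢ e∈ = ℕ.<⇒≢ (proj₁ (E⁻ G e∈)) ∘ cong toℕ

  triangle-adj : ∀ {a b c x y} → IsTriangle G a b c →
    x ∈ˡ a ∷ b ∷ c ∷ [] → y ∈ˡ a ∷ b ∷ c ∷ [] → x ≢ y → Adj G x y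
  triangle-adj _ (here refl) (here refl) x≢y = contradiction refl x≢y
  triangle-adj (ab , _ , _) (here refl) (there (here refl)) _ = ab
  triangle-adj (_ , ac , _) (here refl) (there (there (here refl))) _ = ac
  triangle-adj (ab , _ , _) (there (here refl)) (here refl) _ = N-sym G ab
  triangle-adj _ (there (here refl)) (there (here refl)) x≢y = contradiction refl x≢y
  triangle-adj (_ , _ , bc) (there (here refl)) (there (there (here refl))) _ = bc
  triangle-adj (_ , ac , _) (there (there (here refl))) (here refl) _ = N-sym G ac
  triangle-adj (_ , _ , bc) (there (there (here refl))) (there (here refl)) _ = N-sym G bc
  triangle-adj _ (there (there (here refl))) (there (there (here refl))) x≢y = contradiction refl x≢y

  triangle-neighbour : ∀ {a b c x} → IsTriangle G a b c → x ∈ˡ a ∷ b ∷ c ∷ [] →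
    ∃[ y ] y ∈ˡ a ∷ b ∷ c ∷ [] × Adj G x y
  triangle-neighbour (ab , _ , _) (here refl) = _ , there (here refl) , ab
  triangle-neighbour (ab , _ , _) (there (here refl)) = _ , here refl , N-sym G ab
  triangle-neighbour (_ , ac , _) (there (there (here refl))) = _ , here refl , N-sym G ac

  -- `S` holds the centres of the stars and `T` the triangles. Since `T` is a relation on ordered
  -- triples, one triangle may occur in several orders; `T-unique` therefore compares sets of
  -- corners.
  record Decomposition (S : Subset n) (T : (a b c : Fin n) → Set) : Set where
    field
      strong   : ∀ {u} → u ∈ S → IsStrongVertex G u
      indep    : ∀ {u v} → u ∈ S → v ∈ S → ¬ Adj G u v
      triangle : ∀ {a b c} → T a b c → IsTriangle G a b c
      squeezed : ∀ {a b c} → T a b c → Squeezed (a ∷ b ∷ c ∷ [])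
      avoids   : ∀ {a b c x} → T a b c → x ∈ˡ a ∷ b ∷ c ∷ [] → x ∉ S
      T-unique : ∀ {a b c a′ b′ c′ x y z} → T a b c → T a′ b′ c′ → x ≢ y →
        x ∈ˡ a ∷ b ∷ c ∷ [] → y ∈ˡ a ∷ b ∷ c ∷ [] → x ∈ˡ a′ ∷ b′ ∷ c′ ∷ [] →
        y ∈ˡ a′ ∷ b′ ∷ c′ ∷ [] → z ∈ˡ a ∷ b ∷ c ∷ [] → z ∈ˡ a′ ∷ b′ ∷ c′ ∷ []
      cover    : ∀ {x y} → Adj G x y → x ∈ S ⊎ y ∈ S ⊎
        (∃[ a ] ∃[ b ] ∃[ c ] T a b c × x ∈ˡ a ∷ b ∷ c ∷ [] × y ∈ˡ a ∷ b ∷ c ∷ [])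

  -- The parts are the classes of the relation "in the same star or in the same triangle". Its
  -- transitivity is the disjointness of the pieces: `indep` excludes an edge with two centres,
  -- `avoids` an edge both in a star and in a triangle, and `T-unique` an edge in two different
  -- triangles.
  decomposition⇒localizable : ∀ {S T} → (∀ a b c → Dec (T a b c)) →
    Decomposition S T → Localizable (L G)
  decomposition⇒localizable {S} {T} T? D =
    localizable-by-classes (L G) R R? R-refl R-sym R-trans (proj₁ ∘ proj₂)
      (λ {e} e∈ → (proj₁ ∘ proj₂ ∘ ∈-sep⁻ (R? e) , clique {e}) , meets e∈)
    where
    open Decomposition D
    SameStar SameTriangle R : (e f : Fin (n * n)) → Set
    SameStar e f = ∃[ u ] u ∈ S × Incident u e × Incident u f
    SameTriangle e f = ∃[ a ] ∃[ b ] ∃[ c ]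
      T a b c × Within e (a ∷ b ∷ c ∷ []) × Within f (a ∷ b ∷ c ∷ [])
    R e f = e ∈ E G × f ∈ E G × (SameStar e f ⊎ SameTriangle e f)

    R? : ∀ e f → Dec (R e f)
    R? e f = (e ∈? E G) ×-dec (f ∈? E G) ×-dec
      ((any? λ u → (u ∈? S) ×-dec incident? u e ×-dec incident? u f)
      ⊎-dec (any? λ a → any? λ b → any? λ c → T? a b c ×-dec
        within? e (a ∷ b ∷ c ∷ []) ×-dec within? f (a ∷ b ∷ c ∷ [])))

    R-refl : ∀ {e} → e ∈ E G → R e e
    R-refl e∈ with E-at G e∈ (inj₁ refl)
    ... | y , a , e≡ with cover a
    ... | inj₁ x∈S = e∈ , e∈ , inj₁ (_ , x∈S , inj₁ refl , inj₁ refl)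
    ... | inj₂ (inj₁ y∈S) = e∈ , e∈ , inj₁ (y , y∈S , ye , ye)
      where ye = subst (Incident y) (sym e≡) (incident₂ _ y)
    ... | inj₂ (inj₂ (a , b , c , t , x∈ , y∈)) = e∈ , e∈ , inj₂ (a , b , c , t , w , w)
      where w = subst (λ e → Within e _) (sym e≡) (within⁺ x∈ y∈)

    R-sym : ∀ {e f} → R e f → R f e
    R-sym (e∈ , f∈ , inj₁ (u , u∈ , ue , uf))         = f∈ , e∈ , inj₁ (u , u∈ , uf , ue)
    R-sym (e∈ , f∈ , inj₂ (a , b , c , t , we , wf)) = f∈ , e∈ , inj₂ (a , b , c , t , wf , we)

    R-trans : ∀ {e f g} → R e f → R f g → R e g
    R-trans (e∈ , f∈ , inj₁ (u , u∈ , ue , uf)) (_ , g∈ , inj₁ (v , v∈ , vf , vg)) with u ≟ v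
    ... | yes refl = e∈ , g∈ , inj₁ (u , u∈ , ue , vg)
    ... | no  u≢v  = contradiction (proj₂ (E-two-ends f∈ uf vf u≢v)) (indep u∈ v∈)
    R-trans (_ , _ , inj₁ (u , u∈ , ue , uf)) (_ , _ , inj₂ (_ , _ , _ , t , wf , _)) =
      contradiction u∈ (avoids t (within⁻ wf uf))
    R-trans (_ , _ , inj₂ (_ , _ , _ , t , _ , wf)) (_ , _ , inj₁ (u , u∈ , uf , _)) =
      contradiction u∈ (avoids t (within⁻ wf uf))
    R-trans (e∈ , f∈ , inj₂ (_ , _ , _ , t , we , wf)) (_ , g∈ , inj₂ (_ , _ , _ , t′ , wf′ , wg)) =
      e∈ , g∈ , inj₂ (_ , _ , _ , t′ , (transfer (proj₁ we) , transfer (proj₂ we)) , wg)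
      where
      transfer : ∀ {z} → z ∈ˡ _ → z ∈ˡ _
      transfer = T-unique t t′ (ends-≢ f∈) (proj₁ wf) (proj₂ wf) (proj₁ wf′) (proj₂ wf′)

    share : ∀ {f g} → R f g → ∃[ v ] Incident v f × Incident v g
    share (_ , _ , inj₁ (u , _ , uf , ug)) = u , uf , ug
    share {f} {g} (f∈ , g∈ , inj₂ (_ , _ , _ , _ , wf , wg)) =
      case two-pairs-in-triple-meet (s≤s (s≤s (s≤s z≤n))) (ends-≢ f∈) (ends-≢ g∈)
             (proj₁ wf) (proj₂ wf) (proj₁ wg) (proj₂ wg) of λ
        { (inj₁ p≡r)               → end₁ f , inj₁ refl , inj₁ p≡r
        ; (inj₂ (inj₁ p≡s))        → end₁ f , inj₁ refl , inj₂ p≡s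
        ; (inj₂ (inj₂ (inj₁ q≡r))) → end₂ f , inj₂ refl , inj₁ q≡r
        ; (inj₂ (inj₂ (inj₂ q≡s))) → end₂ f , inj₂ refl , inj₂ q≡s }

    clique : ∀ {e f g} → f ∈ sep (R? e) → g ∈ sep (R? e) → f ≢ g → Adj (L G) f g
    clique {e} {f} f∈ g∈ f≢g = let r = R-trans (R-sym (∈-sep⁻ (R? e) f∈)) (∈-sep⁻ (R? e) g∈) in
      ∈-sep⁺ (lineAdj? G f) (proj₁ r , proj₁ (proj₂ r) , f≢g , share r)

    meets : ∀ {e I} → e ∈ E G → IsMaximalIndependent (L G) I → Nonempty (sep (R? e) ∩ I)
    meets {e} e∈ iI with R-refl e∈ | maximalIndependent⇒maximalMatching G iI
    ... | _ , _ , inj₁ (u , u∈ , ue , _) | max with proj₂ (strong u∈) max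
    ... | f , f∈I , uf =
      f , x∈p∩q⁺ (∈-sep⁺ (R? e) (e∈ , proj₁ (proj₁ max) f∈I , inj₁ (u , u∈ , ue , uf)) , f∈I)
    meets {e} e∈ iI | _ , _ , inj₂ (a , b , c , t , we , _) | max
      with squeezed⇒meets (triangle t) (squeezed t) max
    ... | p , q , p∈ , q∈ , pq∈I = edge p q , x∈p∩q⁺
      (∈-sep⁺ (R? e) (e∈ , proj₁ (proj₁ max) pq∈I , inj₂ (a , b , c , t , we , within⁺ p∈ q∈)) , pq∈I)

  -- The two shapes of a strong clique

  data StrongCliqueView (C : Subset (n * n)) : Set where
    starEdges : ∀ v → IsStrongVertex G v → (∀ {e} → e ∈ C ⇔ (e ∈ E G × Incident v e)) → StrongCliqueView C
    triangleEdges : ∀ a b c → IsTriangle G a b c → Squeezed (a ∷ b ∷ c ∷ []) →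
      (∀ {e} → e ∈ C ⇔ (e ∈ E G × Within e (a ∷ b ∷ c ∷ []))) → StrongCliqueView C

  module _ {C : Subset (n * n)} (strongC : IsStrongClique (L G) C) where

    private
      C⊆E : C ⊆ E G
      C⊆E = proj₁ (proj₁ strongC)

      pairwise-meet : ∀ {e f} → e ∈ C → f ∈ C → ∃[ v ] Incident v e × Incident v f
      pairwise-meet {e} {f} e∈ f∈ with e ≟ f
      ... | yes refl = end₁ e , inj₁ refl , inj₁ refl
      ... | no  e≢f  = L-adj⁻ G (proj₂ (proj₁ strongC) e∈ f∈ e≢f)

      meet : ∀ {e} {u v : Fin n} → e ∈ C → edge u v ∈ C → Incident u e ⊎ Incident v e
      meet {e} {u} {v} e∈ uv∈ with pairwise-meet e∈ uv∈
      ... | w , we , wuv with incident⁻ u v wuv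
      ... | inj₁ refl = inj₁ we
      ... | inj₂ refl = inj₂ we

      hits : ∀ {M} → IsMaximalMatching G M → ∃[ e ] e ∈ C × e ∈ M
      hits {M} max with proj₂ strongC (maximalMatching⇒maximalIndependent G max)
      ... | e , e∈ = e , x∈p∩q⁻ C M e∈

    -- Every maximal matching meets C, hence covers v. A further edge e at v extends to a maximal
    -- matching, whose edge in C also passes through v and so equals e; thus C is the full star.
    starView : ∀ {u v} → Adj G v u → (∀ {e} → e ∈ C → Incident v e) → StrongCliqueView C
    starView {u} {v} a all∋v = starEdges v (N⊆V G (N-sym G a) , covered)
      (mk⇔ (λ e∈ → C⊆E e∈ , all∋v e∈) whole)
      where
      covered : ∀ {M} → IsMaximalMatching G M → Covers G M v
      covered max = let e , e∈C , e∈M = hits max in e , e∈M , all∋v e∈C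
      whole : ∀ {e} → e ∈ E G × Incident v e → e ∈ C
      whole {e} (e∈ , ve) with extend-matching G (singleton-matching G e∈)
      ... | M , max , e∈M with hits max
      ... | f , f∈C , f∈M =
        subst (_∈ C) (proj₂ (proj₁ max) f∈M (e∈M (x∈⁅x⁆ e)) (all∋v f∈C) ve) f∈C

    -- An edge of C meets all three sides, so both its ends are corners. Hence C consists of exactly
    -- these sides, and as a strong clique it meets all maximal matchings.
    triangleView : ∀ {x y z} → IsTriangle G x y z →
      edge x y ∈ C → edge x z ∈ C → edge y z ∈ C → StrongCliqueView C
    triangleView {x} {y} {z} tri@(xy , xz , yz) xy∈ xz∈ yz∈ =
      triangleEdges x y z tri
        (meets⇒squeezed (s≤s (s≤s (s≤s z≤n))) meets)
        (mk⇔ (λ e∈ → C⊆E e∈ , within e∈) λ (e∈ , we) → whole e∈ we)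
      where
      ts = x ∷ y ∷ z ∷ []
      0∈ : x ∈ˡ ts
      0∈ = here refl
      1∈ : y ∈ˡ ts
      1∈ = there (here refl)
      2∈ : z ∈ˡ ts
      2∈ = there (there (here refl))
      within-two : ∀ {e u v} → e ∈ C → Incident u e → Incident v e → u ≢ v →
        u ∈ˡ ts → v ∈ˡ ts → Within e ts
      within-two e∈ ue ve u≢v u∈ v∈ with E-two-ends (C⊆E e∈) ue ve u≢v
      ... | refl , _ = within⁺ u∈ v∈
      within : ∀ {e} → e ∈ C → Within e ts
      within e∈ with meet e∈ xy∈ | meet e∈ yz∈ | meet e∈ xz∈
      ... | inj₁ xe | inj₁ ye | _       = within-two e∈ xe ye (Adj⇒≢ G xy) 0∈ 1∈
      ... | inj₁ xe | inj₂ ze | _       = within-two e∈ xe ze (Adj⇒≢ G xz) 0∈ 2∈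
      ... | inj₂ ye | _       | inj₁ xe = within-two e∈ xe ye (Adj⇒≢ G xy) 0∈ 1∈
      ... | inj₂ ye | _       | inj₂ ze = within-two e∈ ye ze (Adj⇒≢ G yz) 1∈ 2∈
      edge∈C : ∀ {p q} → p ∈ˡ ts → q ∈ˡ ts → p ≢ q → edge p q ∈ C
      edge∈C (here refl) (here refl) p≢q = contradiction refl p≢q
      edge∈C (here refl) (there (here refl)) _ = xy∈
      edge∈C (here refl) (there (there (here refl))) _ = xz∈
      edge∈C (there (here refl)) (here refl) _ = edge∈-comm xy∈
      edge∈C (there (here refl)) (there (here refl)) p≢q = contradiction refl p≢q
      edge∈C (there (here refl)) (there (there (here refl))) _ = yz∈
      edge∈C (there (there (here refl))) (here refl) _ = edge∈-comm xz∈
      edge∈C (there (there (here refl))) (there (here refl)) _ = edge∈-comm yz∈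
      edge∈C (there (there (here refl))) (there (there (here refl))) p≢q = contradiction refl p≢q
      whole : ∀ {e} → e ∈ E G → Within e ts → e ∈ C
      whole e∈ we with E-at G e∈ (inj₁ refl)
      ... | q , a , e≡ = subst (_∈ C) (sym e≡)
        (edge∈C (proj₁ we) (within⁻ we (subst (Incident q) (sym e≡) (incident₂ _ q))) (Adj⇒≢ G a))
      meets : MeetsMaximalMatchings ts
      meets {M} max with hits max
      ... | e , e∈C , e∈M with within e∈C | E-at G (C⊆E e∈C) (inj₁ refl)
      ... | we | q , a , e≡ = _ , q , proj₁ we ,
        within⁻ we (subst (Incident q) (sym e≡) (incident₂ _ q)) , subst (_∈ M) e≡ e∈M

    -- Fix an edge xy of C. If neither end is common to all of C, some f in C misses x and some g in
    -- C misses y. Meeting xy, they are f = yz and g = xw, and meeting each other they force z = w.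
    strongCliqueView : Nonempty C → StrongCliqueView C
    strongCliqueView (e , e∈) with E-at G (C⊆E e∈) (inj₁ refl)
    ... | y , xy , e≡ = from-edge xy (subst (_∈ C) e≡ e∈)
      where
      Missed : Fin n → Set
      Missed v = ∃[ f ] f ∈ C × ¬ Incident v f
      missed? : ∀ v → Dec (Missed v)
      missed? v = any? λ f → (f ∈? C) ×-dec ¬? (incident? v f)
      all∋ : ∀ {v} → ¬ Missed v → ∀ {f} → f ∈ C → Incident v f
      all∋ {v} ¬missed {f} f∈ with incident? v f
      ... | yes vf = vf
      ... | no ¬vf = contradiction (f , f∈ , ¬vf) ¬missed
      from-edge : ∀ {x y} → Adj G x y → edge x y ∈ C → StrongCliqueView C
      from-edge {x} {y} xy xy∈ with missed? x | missed? y
      ... | no ¬x | _     = starView xy (all∋ ¬x)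
      ... | _     | no ¬y = starView (N-sym G xy) (all∋ ¬y)
      ... | yes (f , f∈ , x∉f) | yes (g , g∈ , y∉g) with meet f∈ xy∈ | meet g∈ xy∈
      ... | inj₁ x∈f | _        = contradiction x∈f x∉f
      ... | _        | inj₂ y∈g = contradiction y∈g y∉g
      ... | inj₂ y∈f | inj₁ x∈g with E-at G (C⊆E f∈) y∈f | E-at G (C⊆E g∈) x∈g
      ... | z , yz , refl | w , xw , refl with meet f∈ g∈
      ... | inj₁ x∈f  = contradiction x∈f x∉f
      ... | inj₂ wf with incident⁻ y z wf
      ... | inj₁ refl = contradiction (incident₂ x w) y∉g
      ... | inj₂ refl = triangleView (xy , xw , yz) xy∈ g∈ f∈

  -- The decomposition given by a partition into strong cliques

  module _ (loc : Localizable (L G)) where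
    private
      C : Fin (proj₁ loc) → Subset (n * n)
      C = proj₁ (proj₂ loc)
      partition : IsPartition (L G) C
      partition = proj₁ (proj₂ (proj₂ loc))

      view : ∀ i → StrongCliqueView (C i)
      view i = strongCliqueView (proj₂ (proj₂ (proj₂ loc)) i) (proj₁ (proj₁ partition i))

      same-part : ∀ {e i j} → e ∈ E G → e ∈ C i → e ∈ C j → i ≡ j
      same-part e∈ e∈i e∈j = let _ , _ , unique = proj₂ partition e∈ in
        trans (sym (unique e∈i)) (unique e∈j)

      -- Read off the chosen view and not off the set D: when a component is a single edge, that
      -- edge is the full star of either end, and only one end may become a centre.
      Centre : ∀ {D} → StrongCliqueView D → Fin n → Set
      Centre (starEdges v _ _)           u = u ≡ v
      Centre (triangleEdges _ _ _ _ _ _) u = ⊥ᵗ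

      centre? : ∀ {D} (s : StrongCliqueView D) u → Dec (Centre s u)
      centre? (starEdges v _ _)           u = u ≟ v
      centre? (triangleEdges _ _ _ _ _ _) u = no λ ()

      Corners : ∀ {D} → StrongCliqueView D → (a b c : Fin n) → Set
      Corners (starEdges _ _ _)              a b c = ⊥ᵗ
      Corners (triangleEdges a′ b′ c′ _ _ _) a b c = a ≡ a′ × b ≡ b′ × c ≡ c′

      corners? : ∀ {D} (s : StrongCliqueView D) a b c → Dec (Corners s a b c)
      corners? (starEdges _ _ _)              a b c = no λ ()
      corners? (triangleEdges a′ b′ c′ _ _ _) a b c = (a ≟ a′) ×-dec (b ≟ b′) ×-dec (c ≟ c′)

      isCentre? : ∀ u → Dec (∃[ i ] Centre (view i) u)
      isCentre? u = any? λ i → centre? (view i) u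

      centre-strong : ∀ {D u} (s : StrongCliqueView D) → Centre s u → IsStrongVertex G u
      centre-strong (starEdges _ strong _) refl = strong

      centre-edge : ∀ {D u v} (s : StrongCliqueView D) → Centre s u → Adj G u v → edge u v ∈ D
      centre-edge (starEdges _ _ star⇔) refl a = Equivalence.from star⇔ (edge∈E G a , incident₁ _ _)

      corners-edge : ∀ {D a b c u v} (s : StrongCliqueView D) → Corners s a b c →
        u ∈ˡ a ∷ b ∷ c ∷ [] → v ∈ˡ a ∷ b ∷ c ∷ [] → Adj G u v → edge u v ∈ D
      corners-edge (triangleEdges _ _ _ _ _ tri⇔) (refl , refl , refl) u∈ v∈ a =
        Equivalence.from tri⇔ (edge∈E G a , within⁺ u∈ v∈)

      corners-triangle : ∀ {D a b c} (s : StrongCliqueView D) → Corners s a b c → IsTriangle G a b c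
      corners-triangle (triangleEdges _ _ _ tri _ _) (refl , refl , refl) = tri

      corners-squeezed : ∀ {D a b c} (s : StrongCliqueView D) → Corners s a b c →
        Squeezed (a ∷ b ∷ c ∷ [])
      corners-squeezed (triangleEdges _ _ _ _ sq _) (refl , refl , refl) = sq

      centre-unique : ∀ {D u v} (s : StrongCliqueView D) → Centre s u → Centre s v → u ≡ v
      centre-unique (starEdges _ _ _) refl refl = refl

      corners-unique : ∀ {D a b c a′ b′ c′ z} (s : StrongCliqueView D) → Corners s a b c →
        Corners s a′ b′ c′ → z ∈ˡ a ∷ b ∷ c ∷ [] → z ∈ˡ a′ ∷ b′ ∷ c′ ∷ []
      corners-unique (triangleEdges _ _ _ _ _ _) (refl , refl , refl) (refl , refl , refl) z∈ = z∈

      ¬centre-corners : ∀ {D u a b c} (s : StrongCliqueView D) → Centre s u → ¬ Corners s a b c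
      ¬centre-corners (starEdges _ _ _) _ ()

    -- Two adjacent centres, a centre at a corner of a triangle, or two triangles with two common
    -- vertices all place one edge in two parts. The parts then coincide, and one view has one
    -- centre or one set of corners.
    localizable⇒decomposition : ∃[ S ] ∃[ T ] (∀ a b c → Dec (T a b c)) × Decomposition S T
    localizable⇒decomposition = S , T , (λ a b c → any? λ i → corners? (view i) a b c) , record
      { strong   = λ u∈ → let i , c = ∈-sep⁻ isCentre? u∈ in centre-strong (view i) c
      ; indep    = indep
      ; triangle = λ (i , t) → corners-triangle (view i) t
      ; squeezed = λ (i , t) → corners-squeezed (view i) t
      ; avoids   = avoids
      ; T-unique = T-unique
      ; cover    = cover
      }
      where
      S : Subset n
      S = sep isCentre?
      T : (a b c : Fin n) → Set
      T a b c = ∃[ i ] Corners (view i) a b c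
      indep : ∀ {u v} → u ∈ S → v ∈ S → ¬ Adj G u v
      indep u∈ v∈ a with ∈-sep⁻ isCentre? u∈ | ∈-sep⁻ isCentre? v∈
      ... | i , ci | j , cj with same-part (edge∈E G a) (centre-edge (view i) ci a)
                                (edge∈-comm (centre-edge (view j) cj (N-sym G a)))
      ... | refl = Adj⇒≢ G a (centre-unique (view i) ci cj)
      avoids : ∀ {a b c x} → T a b c → x ∈ˡ a ∷ b ∷ c ∷ [] → x ∉ S
      avoids (i , t) x∈ x∈S with ∈-sep⁻ isCentre? x∈S
      ... | j , cj with triangle-neighbour (corners-triangle (view i) t) x∈
      ... | y , y∈ , a with same-part (edge∈E G a) (corners-edge (view i) t x∈ y∈ a)
                              (centre-edge (view j) cj a)
      ... | refl = ¬centre-corners (view i) cj t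
      T-unique : ∀ {a b c a′ b′ c′ x y z} → T a b c → T a′ b′ c′ → x ≢ y →
        x ∈ˡ a ∷ b ∷ c ∷ [] → y ∈ˡ a ∷ b ∷ c ∷ [] → x ∈ˡ a′ ∷ b′ ∷ c′ ∷ [] →
        y ∈ˡ a′ ∷ b′ ∷ c′ ∷ [] → z ∈ˡ a ∷ b ∷ c ∷ [] → z ∈ˡ a′ ∷ b′ ∷ c′ ∷ []
      T-unique (i , t) (j , t′) x≢y x∈ y∈ x∈′ y∈′ z∈
        with triangle-adj (corners-triangle (view i) t) x∈ y∈ x≢y
      ... | a with same-part (edge∈E G a) (corners-edge (view i) t x∈ y∈ a)
                     (corners-edge (view j) t′ x∈′ y∈′ a)
      ... | refl = corners-unique (view i) t t′ z∈
      cover : ∀ {x y} → Adj G x y → x ∈ S ⊎ y ∈ S ⊎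
        (∃[ a ] ∃[ b ] ∃[ c ] T a b c × x ∈ˡ a ∷ b ∷ c ∷ [] × y ∈ˡ a ∷ b ∷ c ∷ [])
      cover {x} {y} xy with proj₂ partition (edge∈E G xy)
      ... | i , e∈ , _ with view i in eq
      ... | triangleEdges a b c _ _ tri⇔ = let we = proj₂ (Equivalence.to tri⇔ e∈) in
        inj₂ (inj₂ (a , b , c , (i , subst (λ s → Corners s a b c) (sym eq) (refl , refl , refl)) ,
          within⁻ we (incident₁ x y) , within⁻ we (incident₂ x y)))
      ... | starEdges v _ star⇔ with incident⁻ x y (proj₂ (Equivalence.to star⇔ e∈))
      ... | inj₁ refl = inj₁ (∈-sep⁺ isCentre? (i , subst (λ s → Centre s v) (sym eq) refl))
      ... | inj₂ refl = inj₂ (inj₁ (∈-sep⁺ isCentre? (i , subst (λ s → Centre s v) (sym eq) refl)))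

-- Pendant subgraphs

pattern 1st = here refl
pattern 2nd = there (here refl)
pattern 3rd = there (there (here refl))

module _ (H : Graph n) where

  N≡2 : ∀ {a b c} → Adj H a b → Adj H a c → b ≢ c → deg H a ≡ 2 →
    ∀ {x} → Adj H a x → x ∈ˡ b ∷ c ∷ []
  N≡2 {a} ab ac b≢c d = ∣p∣≤length⇒p⊆ (N H a) (Unique₂ b≢c)
    (λ { 1st → ab ; 2nd → ac }) (ℕ.≤-reflexive d)

  N≡3 : ∀ {a b c d} → Adj H a b → Adj H a c → Adj H a d → b ≢ c → b ≢ d → c ≢ d → deg H a ≡ 3 →
    ∀ {x} → Adj H a x → x ∈ˡ b ∷ c ∷ d ∷ []
  N≡3 {a} ab ac ad b≢c b≢d c≢d d = ∣p∣≤length⇒p⊆ (N H a) (Unique₃ b≢c b≢d c≢d)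
    (λ { 1st → ab ; 2nd → ac ; 3rd → ad }) (ℕ.≤-reflexive d)

  -- A pendant subgraph with strong triangle a b c, non-root vertices ns and root r.
  data Pendant : (a b c : Fin n) (ns : List (Fin n)) (r : Fin n) → Set where
    tri : ∀ {a b c}   → PendantTriangle H a b c  → Pendant a b c (a ∷ b ∷ []) c
    dia : ∀ {a b c d} → PendantDiamond H a b c d → Pendant a b c (a ∷ b ∷ c ∷ []) d
    k₄  : ∀ {a b c d} → PendantK₄ H a b c d      → Pendant a b c (a ∷ b ∷ c ∷ []) d

  diamond-swap : ∀ {a b c d} → PendantDiamond H a b c d → PendantDiamond H a c b d
  diamond-swap ((ab , ac , bc , bd , cd , a≢d , ¬ad) , da , db , dc , dd) =
    (ac , ab , N-sym H bc , cd , bd , a≢d , ¬ad) , da , dc , db , dd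

  K₄-swap : ∀ {a b c d} → PendantK₄ H a b c d → PendantK₄ H b a c d
  K₄-swap ((ab , ac , ad , bc , bd , cd) , da , db , dc , dd) =
    (N-sym H ab , bc , bd , ac , ad , cd) , db , da , dc , dd

  K₄-rotate : ∀ {a b c d} → PendantK₄ H a b c d → PendantK₄ H b c a d
  K₄-rotate ((ab , ac , ad , bc , bd , cd) , da , db , dc , dd) =
    (bc , N-sym H ab , bd , N-sym H ac , cd , ad) , db , dc , da , dd

  module _ {a b c d} (p : PendantDiamond H a b c d) where
    diamond-N₁ : ∀ {x} → Adj H a x → x ∈ˡ b ∷ c ∷ []
    diamond-N₁ = let (ab , ac , bc , _) , da , _ = p in N≡2 ab ac (Adj⇒≢ H bc) da

    diamond-N₂ : ∀ {x} → Adj H b x → x ∈ˡ a ∷ c ∷ d ∷ []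
    diamond-N₂ = let (ab , ac , bc , bd , cd , a≢d , _) , _ , db , _ = p in
      N≡3 (N-sym H ab) bc bd (Adj⇒≢ H ac) a≢d (Adj⇒≢ H cd) db

  K₄-N : ∀ {a b c d} → PendantK₄ H a b c d → ∀ {x} → Adj H a x → x ∈ˡ b ∷ c ∷ d ∷ []
  K₄-N ((ab , ac , ad , bc , bd , cd) , da , _) =
    N≡3 ab ac ad (Adj⇒≢ H bc) (Adj⇒≢ H bd) (Adj⇒≢ H cd) da

  triangle-swap : ∀ {a b c} → PendantTriangle H a b c → PendantTriangle H b a c
  triangle-swap ((ab , ac , bc) , da , db , dc) = (N-sym H ab , bc , ac) , db , da , dc

  triangle-N : ∀ {a b c} → PendantTriangle H a b c → ∀ {x} → Adj H a x → x ∈ˡ b ∷ c ∷ []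
  triangle-N ((ab , ac , bc) , da , _) = N≡2 ab ac (Adj⇒≢ H bc) da

  pendant-triangle : ∀ {a b c ns r} → Pendant a b c ns r → IsTriangle H a b c
  pendant-triangle (tri (t , _)) = t
  pendant-triangle (dia ((ab , ac , bc , _) , _)) = ab , ac , bc
  pendant-triangle (k₄ ((ab , ac , _ , bc , _) , _)) = ab , ac , bc

  -- The prescribed degrees leave a non-root no room for further neighbours, so only the root links
  -- a pendant subgraph to the rest of H.
  closed : ∀ {a b c ns r x y} → Pendant a b c ns r → x ∈ˡ ns → Adj H x y → y ∈ˡ ns ⊎ y ≡ r
  closed (tri p) 1st xy with triangle-N p xy
  ... | 1st = inj₁ 2nd
  ... | 2nd = inj₂ refl
  closed (tri p) 2nd xy with triangle-N (triangle-swap p) xy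
  ... | 1st = inj₁ 1st
  ... | 2nd = inj₂ refl
  closed (dia p) 1st xy = inj₁ (there (diamond-N₁ p xy))
  closed (dia p) 2nd xy with diamond-N₂ p xy
  ... | 1st = inj₁ 1st
  ... | 2nd = inj₁ 3rd
  ... | 3rd = inj₂ refl
  closed (dia p) 3rd xy with diamond-N₂ (diamond-swap p) xy
  ... | 1st = inj₁ 1st
  ... | 2nd = inj₁ 2nd
  ... | 3rd = inj₂ refl
  closed (k₄ p) 1st xy with K₄-N p xy
  ... | 1st = inj₁ 2nd
  ... | 2nd = inj₁ 3rd
  ... | 3rd = inj₂ refl
  closed (k₄ p) 2nd xy with K₄-N (K₄-rotate p) xy
  ... | 1st = inj₁ 3rd
  ... | 2nd = inj₁ 1st
  ... | 3rd = inj₂ refl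
  closed (k₄ p) 3rd xy with K₄-N (K₄-rotate (K₄-rotate p)) xy
  ... | 1st = inj₁ 1st
  ... | 2nd = inj₁ 2nd
  ... | 3rd = inj₂ refl

  nonRoots⊆corners : ∀ {a b c ns r x} → Pendant a b c ns r → x ∈ˡ ns → x ∈ˡ a ∷ b ∷ c ∷ []
  nonRoots⊆corners (tri _) 1st = 1st
  nonRoots⊆corners (tri _) 2nd = 2nd
  nonRoots⊆corners (dia _) x∈  = x∈
  nonRoots⊆corners (k₄ _)  x∈  = x∈

  corners⊆nonRoots : ∀ {a b c ns r x} → Pendant a b c ns r → x ∈ˡ a ∷ b ∷ c ∷ [] → x ∈ˡ ns ⊎ x ≡ r
  corners⊆nonRoots (tri _) 1st = inj₁ 1st
  corners⊆nonRoots (tri _) 2nd = inj₁ 2nd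
  corners⊆nonRoots (tri _) 3rd = inj₂ refl
  corners⊆nonRoots (dia _) x∈  = inj₁ x∈
  corners⊆nonRoots (k₄ _)  x∈  = inj₁ x∈

  one-nonRoot : ∀ {a b c ns r x y} → Pendant a b c ns r → x ∈ˡ a ∷ b ∷ c ∷ [] → y ∈ˡ a ∷ b ∷ c ∷ [] →
    x ≢ y → x ∈ˡ ns ⊎ y ∈ˡ ns
  one-nonRoot p x∈ y∈ x≢y with corners⊆nonRoots p x∈ | corners⊆nonRoots p y∈
  ... | inj₁ x∈ns | _         = inj₁ x∈ns
  ... | _         | inj₁ y∈ns = inj₂ y∈ns
  ... | inj₂ refl | inj₂ refl = contradiction refl x≢y

  root-deg : ∀ {a b c ns r} → Pendant a b c ns r → 3 ≤ deg H r
  root-deg (tri (_ , _ , _ , d))     = d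
  root-deg (dia (_ , _ , _ , _ , d)) = d
  root-deg (k₄ (_ , _ , _ , _ , d))  = ℕ.<⇒≤ d

  private
    deg-clash : ∀ {x k} → deg H x ≡ k → ¬ k < deg H x
    deg-clash refl = ℕ.<-irrefl refl

    2≢3 : ∀ {x} → deg H x ≡ 2 → deg H x ≢ 3
    2≢3 d₂ d₃ with trans (sym d₂) d₃
    ... | ()

    -- The tip a′ would be a neighbour of b, hence a, c or d. The first is not adjacent to d, and
    -- the other two have degree at least 3.
    diamonds-not-glued : ∀ {a b c d a′ d′} → PendantDiamond H a b c d → ¬ PendantDiamond H a′ d b d′
    diamonds-not-glued p@((_ , _ , _ , _ , _ , _ , ¬ad) , _ , _ , dc , dd) ((a′d , a′b , _) , da′ , _)
      with diamond-N₂ p (N-sym H a′b)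
    ... | 1st = ¬ad a′d
    ... | 2nd = 2≢3 da′ dc
    ... | 3rd = deg-clash da′ dd

    root∉diamond : ∀ {a b c ns r a′ c′ d′} → Pendant a b c ns r → ¬ PendantDiamond H a′ r c′ d′
    root∉diamond (tri ((ab , ar , br) , da , db , _))
                 p′@((_ , _ , _ , _ , _ , _ , ¬a′d′) , _ , _ , dc′ , _)
      with diamond-N₂ p′ (N-sym H ar) | diamond-N₂ p′ (N-sym H br)
    ... | 1st | 1st = Adj⇒≢ H ab refl
    ... | 1st | 3rd = ¬a′d′ ab
    ... | 3rd | 1st = ¬a′d′ (N-sym H ab)
    ... | 3rd | 3rd = Adj⇒≢ H ab refl
    ... | 2nd | _   = 2≢3 da dc′
    ... | _   | 2nd = 2≢3 db dc′
    root∉diamond (dia p@((_ , _ , bc , br , cr , _) , _ , db , dc , _)) p′@(_ , da′ , _)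
      with diamond-N₂ p′ (N-sym H br) | diamond-N₂ p′ (N-sym H cr)
    ... | 1st | _   = 2≢3 da′ db
    ... | _   | 1st = 2≢3 da′ dc
    ... | 2nd | _   = diamonds-not-glued p p′
    ... | _   | 2nd = diamonds-not-glued (diamond-swap p) p′
    ... | 3rd | 3rd = Adj⇒≢ H bc refl
    root∉diamond (k₄ (_ , _ , _ , _ , dr)) (_ , _ , dr′ , _) = deg-clash dr′ dr

    K₄-deg : ∀ {a b c d x} → PendantK₄ H a b c d → x ∈ˡ a ∷ b ∷ c ∷ d ∷ [] → deg H x ≢ 2
    K₄-deg (_ , da , _) 1st d₂ = 2≢3 d₂ da
    K₄-deg (_ , _ , db , _) 2nd d₂ = 2≢3 d₂ db
    K₄-deg (_ , _ , _ , dc , _) 3rd d₂ = 2≢3 d₂ dc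
    K₄-deg (_ , _ , _ , _ , dd) (there (there (there 1st))) d₂ = deg-clash d₂ (ℕ.<⇒≤ dd)

    K₄-two-steps : ∀ {r b′ c′ d′ b a} → PendantK₄ H r b′ c′ d′ → Adj H r b → b ≢ d′ → Adj H b a → deg H a ≢ 2
    K₄-two-steps p rb b≢d′ ba with K₄-N p rb
    ... | 1st = K₄-deg (K₄-rotate p) (there (K₄-N (K₄-rotate p) ba))
    ... | 2nd = K₄-deg (K₄-rotate (K₄-rotate p)) (there (K₄-N (K₄-rotate (K₄-rotate p)) ba))
    ... | 3rd = contradiction refl b≢d′

    -- All vertices of the pendant K4 have degree at least 3, but a vertex of degree 2 would lie in
    -- it. For a diamond this is its tip a, reached from r through b or c; one of these differs from
    -- d′, and through it the path stays inside the K4.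
    root∉K₄ : ∀ {a b c ns r b′ c′ d′} → Pendant a b c ns r → ¬ PendantK₄ H r b′ c′ d′
    root∉K₄ (tri ((ab , ar , br) , da , db , _)) p′ = K₄-deg p′ (there (K₄-N p′ (N-sym H ar))) da
    root∉K₄ {b = b} {d′ = d′} (dia ((ab , ac , bc , br , cr , _) , da , _)) p′ with b ≟ d′
    ... | no  b≢d′ = K₄-two-steps p′ (N-sym H br) b≢d′ (N-sym H ab) da
    ... | yes refl = K₄-two-steps p′ (N-sym H cr) (Adj⇒≢ H bc ∘ sym) (N-sym H ac) da
    root∉K₄ (k₄ (_ , _ , _ , _ , dr)) (_ , dr′ , _) = deg-clash dr′ dr

  -- Since all non-roots are deleted at once, a root of one pendant subgraph must not be a non-root
  -- of another. Roots have degree at least 3, which leaves the middle vertices of diamonds and the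
  -- non-roots of a K4 as the cases with content.
  root∉nonRoots : ∀ {a b c ns r a′ b′ c′ ns′ r′} → Pendant a b c ns r → Pendant a′ b′ c′ ns′ r′ → r ∉ˡ ns′
  root∉nonRoots p (tri (_ , da , _)) 1st     = deg-clash da (root-deg p)
  root∉nonRoots p (tri (_ , _ , db , _)) 2nd = deg-clash db (root-deg p)
  root∉nonRoots p (dia (_ , da , _)) 1st     = deg-clash da (root-deg p)
  root∉nonRoots p (dia p′) 2nd               = root∉diamond p p′
  root∉nonRoots p (dia p′) 3rd               = root∉diamond p (diamond-swap p′)
  root∉nonRoots p (k₄ p′) 1st                = root∉K₄ p p′
  root∉nonRoots p (k₄ p′) 2nd                = root∉K₄ p (K₄-rotate p′)
  root∉nonRoots p (k₄ p′) 3rd                = root∉K₄ p (K₄-rotate (K₄-rotate p′))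

  nonRoot⁺ : ∀ {a b c ns r x} → Pendant a b c ns r → x ∈ˡ ns → NonRoot H x
  nonRoot⁺ (tri p) 1st = inj₁ (_ , _ , _ , p , inj₁ refl)
  nonRoot⁺ (tri p) 2nd = inj₁ (_ , _ , _ , p , inj₂ refl)
  nonRoot⁺ (dia p) 1st = inj₂ (inj₁ (_ , _ , _ , _ , p , inj₁ refl))
  nonRoot⁺ (dia p) 2nd = inj₂ (inj₁ (_ , _ , _ , _ , p , inj₂ (inj₁ refl)))
  nonRoot⁺ (dia p) 3rd = inj₂ (inj₁ (_ , _ , _ , _ , p , inj₂ (inj₂ refl)))
  nonRoot⁺ (k₄ p)  1st = inj₂ (inj₂ (_ , _ , _ , _ , p , inj₁ refl))
  nonRoot⁺ (k₄ p)  2nd = inj₂ (inj₂ (_ , _ , _ , _ , p , inj₂ (inj₁ refl)))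
  nonRoot⁺ (k₄ p)  3rd = inj₂ (inj₂ (_ , _ , _ , _ , p , inj₂ (inj₂ refl)))

  nonRoot⁻ : ∀ {x} → NonRoot H x →
    ∃[ a ] ∃[ b ] ∃[ c ] ∃[ ns ] ∃[ r ] Pendant a b c ns r × x ∈ˡ ns
  nonRoot⁻ (inj₁ (_ , _ , _ , p , inj₁ refl)) = _ , _ , _ , _ , _ , tri p , 1st
  nonRoot⁻ (inj₁ (_ , _ , _ , p , inj₂ refl)) = _ , _ , _ , _ , _ , tri p , 2nd
  nonRoot⁻ (inj₂ (inj₁ (_ , _ , _ , _ , p , inj₁ refl))) = _ , _ , _ , _ , _ , dia p , 1st
  nonRoot⁻ (inj₂ (inj₁ (_ , _ , _ , _ , p , inj₂ (inj₁ refl)))) = _ , _ , _ , _ , _ , dia p , 2nd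
  nonRoot⁻ (inj₂ (inj₁ (_ , _ , _ , _ , p , inj₂ (inj₂ refl)))) = _ , _ , _ , _ , _ , dia p , 3rd
  nonRoot⁻ (inj₂ (inj₂ (_ , _ , _ , _ , p , inj₁ refl))) = _ , _ , _ , _ , _ , k₄ p , 1st
  nonRoot⁻ (inj₂ (inj₂ (_ , _ , _ , _ , p , inj₂ (inj₁ refl)))) = _ , _ , _ , _ , _ , k₄ p , 2nd
  nonRoot⁻ (inj₂ (inj₂ (_ , _ , _ , _ , p , inj₂ (inj₂ refl)))) = _ , _ , _ , _ , _ , k₄ p , 3rd

  root-¬nonRoot : ∀ {a b c ns r} → Pendant a b c ns r → ¬ NonRoot H r
  root-¬nonRoot p nr with nonRoot⁻ nr
  ... | _ , _ , _ , _ , _ , p′ , r∈ = root∉nonRoots p p′ r∈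

  corner-root : ∀ {a b c ns r} → Pendant a b c ns r → r ∈ˡ a ∷ b ∷ c ∷ [] →
    ns ≡ a ∷ b ∷ [] × PendantTriangle H a b r
  corner-root (tri p) _   = refl , p
  corner-root p@(dia _) r∈ = contradiction r∈ (root∉nonRoots p p)
  corner-root p@(k₄ _)  r∈ = contradiction r∈ (root∉nonRoots p p)

  -- If the root is a corner, no other corner has a neighbour outside the triangle; otherwise every
  -- edge that leaves the triangle ends in the root.
  pendant-squeezed : ∀ {a b c ns r} → Pendant a b c ns r → Squeezed H (a ∷ b ∷ c ∷ [])
  pendant-squeezed P {p} {q} {x} {y} p∈ q∈ p≢q px x∉ qy y∉
    with corners⊆nonRoots P p∈ | corners⊆nonRoots P q∈
  ... | inj₂ refl | inj₂ refl = contradiction refl p≢q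
  ... | inj₁ p∈ns | inj₂ refl with closed P p∈ns px
  ... | inj₁ x∈ns = contradiction (nonRoots⊆corners P x∈ns) x∉
  ... | inj₂ refl = contradiction q∈ x∉
  pendant-squeezed P p∈ q∈ p≢q px x∉ qy y∉ | inj₂ refl | inj₁ q∈ns with closed P q∈ns qy
  ... | inj₁ y∈ns = contradiction (nonRoots⊆corners P y∈ns) y∉
  ... | inj₂ refl = contradiction p∈ y∉
  pendant-squeezed P p∈ q∈ p≢q px x∉ qy y∉ | inj₁ p∈ns | inj₁ q∈ns
    with closed P p∈ns px | closed P q∈ns qy
  ... | inj₁ x∈ns | _         = contradiction (nonRoots⊆corners P x∈ns) x∉
  ... | _         | inj₁ y∈ns = contradiction (nonRoots⊆corners P y∈ns) y∉
  ... | inj₂ refl | inj₂ refl = refl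

  -- Suppose z is not a corner of the second triple. One of x and y is a non-root there, and it is
  -- adjacent to z, so z = r′. A root is never a non-root, so z is also the root of the first
  -- triple, which is then a pendant triangle with x and y of degree 2. But the second triple does
  -- not contain its root, so it belongs to a diamond or a K4 and has at most one corner of degree
  -- 2.
  pendant-unique : ∀ {a b c ns r a′ b′ c′ ns′ r′ x y z} → Pendant a b c ns r → Pendant a′ b′ c′ ns′ r′ →
    x ≢ y → x ∈ˡ a ∷ b ∷ c ∷ [] → y ∈ˡ a ∷ b ∷ c ∷ [] → x ∈ˡ a′ ∷ b′ ∷ c′ ∷ [] →
    y ∈ˡ a′ ∷ b′ ∷ c′ ∷ [] → z ∈ˡ a ∷ b ∷ c ∷ [] → z ∈ˡ a′ ∷ b′ ∷ c′ ∷ []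
  pendant-unique {a′ = a′} {b′} {c′} {r′ = r′} {x} {y} {z} p p′ x≢y x∈ y∈ x∈′ y∈′ z∈
    with z ∈ˡ? a′ ∷ b′ ∷ c′ ∷ []
  ... | yes z∈′ = z∈′
  ... | no  z∉′ = contradiction z≡r′ z≢r′
    where
    other : ∀ {w} → w ∈ˡ a′ ∷ b′ ∷ c′ ∷ [] → w ≢ z
    other w∈′ refl = z∉′ w∈′
    at-root : ∀ {w} → w ∈ˡ _ → w ∈ˡ _ → Adj H w z → z ≡ r′
    at-root w∈ w∈ns′ wz with closed p′ w∈ns′ wz
    ... | inj₁ z∈ns′ = contradiction (nonRoots⊆corners p′ z∈ns′) z∉′
    ... | inj₂ z≡r′  = z≡r′
    z≡r′ : z ≡ r′
    z≡r′ with one-nonRoot p′ x∈′ y∈′ x≢y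
    ... | inj₁ x∈ns′ = at-root x∈ x∈ns′ (triangle-adj H (pendant-triangle p) x∈ z∈ (other x∈′))
    ... | inj₂ y∈ns′ = at-root y∈ y∈ns′ (triangle-adj H (pendant-triangle p) y∈ z∈ (other y∈′))
    deg-2 : ∀ {a b z w} → PendantTriangle H a b z → w ∈ˡ a ∷ b ∷ [] → deg H w ≡ 2
    deg-2 (_ , da , _) 1st = da
    deg-2 (_ , _ , db , _) 2nd = db
    only-tip : ∀ {a b c ns r x y} → Pendant a b c ns r → r ∉ˡ a ∷ b ∷ c ∷ [] → x ≢ y →
      x ∈ˡ a ∷ b ∷ c ∷ [] → y ∈ˡ a ∷ b ∷ c ∷ [] → deg H x ≡ 2 → deg H y ≢ 2
    only-tip (tri _) r∉ = contradiction 3rd r∉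
    only-tip (dia _) _ x≢y 1st 1st _ _ = x≢y refl
    only-tip (dia (_ , _ , db , _)) _ _ 2nd _ dx _ = 2≢3 dx db
    only-tip (dia (_ , _ , _ , dc , _)) _ _ 3rd _ dx _ = 2≢3 dx dc
    only-tip (dia (_ , _ , db , _)) _ _ _ 2nd _ dy = 2≢3 dy db
    only-tip (dia (_ , _ , _ , dc , _)) _ _ _ 3rd _ dy = 2≢3 dy dc
    only-tip (k₄ q) _ _ 1st _ dx _ = K₄-deg q 1st dx
    only-tip (k₄ q) _ _ 2nd _ dx _ = K₄-deg q 2nd dx
    only-tip (k₄ q) _ _ 3rd _ dx _ = K₄-deg q 3rd dx
    z≢r′ : z ≢ r′
    z≢r′ refl with corners⊆nonRoots p z∈
    ... | inj₁ z∈ns = root∉nonRoots p′ p z∈ns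
    ... | inj₂ refl with corner-root p z∈ | corners⊆nonRoots p x∈ | corners⊆nonRoots p y∈
    ... | _ , _ | inj₂ refl | _ = other x∈′ refl
    ... | _ , _ | _ | inj₂ refl = other y∈′ refl
    ... | refl , t | inj₁ x∈ns | inj₁ y∈ns = only-tip p′ z∉′ x≢y x∈′ y∈′ (deg-2 t x∈ns) (deg-2 t y∈ns)

  IsPendantTriple : (a b c : Fin n) → Set
  IsPendantTriple a b c = ∃[ ns ] ∃[ r ] Pendant a b c ns r

  isPendantTriple? : ∀ a b c → Dec (IsPendantTriple a b c)
  isPendantTriple? a b c = map′
    (λ { (inj₁ p)              → _ , _ , tri p
       ; (inj₂ (inj₁ (_ , p))) → _ , _ , dia p
       ; (inj₂ (inj₂ (_ , p))) → _ , _ , k₄ p })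
    (λ { (_ , _ , tri p) → inj₁ p
       ; (_ , _ , dia p) → inj₂ (inj₁ (_ , p))
       ; (_ , _ , k₄ p)  → inj₂ (inj₂ (_ , p)) })
    (pendantTriangle? H a b c
      ⊎-dec any? (λ d → pendantDiamond? H a b c d)
      ⊎-dec any? (λ d → pendantK₄? H a b c d))

-- Complete graphs and the diamond

Vertex-≡ : {G : Graph n} {x y : Vertex G} → proj₁ x ≡ proj₁ y → x ≡ y
Vertex-≡ {x = x , p} {.x , q} refl = cong (x ,_) ([]=-irrelevant p q)

connected-⊆ : (H : Graph n) → Connected H → (P : Fin n → Set) → ∀ {a} → a ∈ V H → P a →
  (∀ {x y} → P x → Adj H x y → P y) → ∀ {v} → v ∈ V H → P v
connected-⊆ H (_ , path) P a∈ Pa step v∈ = go (path a∈ v∈) Pa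
  where
  go : ∀ {x y} → Star (Adj H) x y → P x → P y
  go ε        Px = Px
  go (xy ◅ s) Px = go s (step Px xy)

complete⇒≅K : (H : Graph n) (xs : List (Fin n)) → (∀ {x} → x ∈ˡ xs → x ∈ V H) →
  AllPairs (Adj H) xs → (∀ {v} → v ∈ V H → v ∈ˡ xs) → H ≅ K (length xs)
complete⇒≅K H xs xs⊆V pairs V⊆xs = record
  { bij  = mk↔ₛ′ to from
      (λ (i , _) → Vertex-≡ {G = K (length xs)} (lookup-injective (sym (index-≡ (xs⊆V (∈-lookup i))))))
      (λ (_ , v∈) → Vertex-≡ {G = H} (sym (index-≡ v∈)))
  ; pres = λ (v , v∈) (w , w∈) → mk⇔
      (λ vw → x∉p⇒x∈∁p λ w∈⁅v⁆ → Adj⇒≢ H vw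
        (trans (index-≡ v∈) (trans (cong (lookup xs) (sym (x∈⁅y⁆⇒x≡y _ w∈⁅v⁆))) (sym (index-≡ w∈)))))
      (λ w∉⁅v⁆ → subst₂ (Adj H) (sym (index-≡ v∈)) (sym (index-≡ w∈))
        (adj λ v≡w → x∈∁p⇒x∉p w∉⁅v⁆ (subst (_ ∈_) (cong ⁅_⁆ (sym v≡w)) (x∈⁅x⁆ _))))
  }
  where
  to : Vertex H → Vertex (K (length xs))
  to (_ , v∈) = Any.index (V⊆xs v∈) , ∈⊤
  from : Vertex (K (length xs)) → Vertex H
  from (i , _) = lookup xs i , xs⊆V (∈-lookup i)
  index-≡ : ∀ {v} (v∈ : v ∈ V H) → v ≡ lookup xs (Any.index (V⊆xs v∈))
  index-≡ v∈ = lookup-index (V⊆xs v∈)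
  adj : ∀ {i j} → i ≢ j → Adj H (lookup xs i) (lookup xs j)
  adj {i} {j} i≢j with AllPairs-lookup pairs i j i≢j
  ... | inj₁ a = a
  ... | inj₂ a = N-sym H a
  lookup-injective : ∀ {i j} → lookup xs i ≡ lookup xs j → i ≡ j
  lookup-injective {i} {j} e with i ≟ j
  ... | yes i≡j = i≡j
  ... | no  i≢j = contradiction e (Adj⇒≢ H (adj i≢j))

module _ {H : Graph n} {Q : Graph m} (iso : H ≅ Q) where
  open _≅_ iso

  from-vertex : ∀ {i} → i ∈ V Q → Fin n
  from-vertex {i} i∈ = proj₁ (from (i , i∈))

  from-∈V : ∀ {i} (i∈ : i ∈ V Q) → from-vertex i∈ ∈ V H
  from-∈V {i} i∈ = proj₂ (from (i , i∈))

  from-adj : ∀ {i j} (i∈ : i ∈ V Q) (j∈ : j ∈ V Q) → Adj Q i j → Adj H (from-vertex i∈) (from-vertex j∈)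
  from-adj i∈ j∈ ij = Equivalence.from (pres _ _)
    (subst₂ (λ x y → Adj Q (proj₁ x) (proj₁ y)) (sym (Inverse.strictlyInverseˡ bij _))
      (sym (Inverse.strictlyInverseˡ bij _)) ij)

  to-≢ : ∀ {x y} (x∈ : x ∈ V H) (y∈ : y ∈ V H) → x ≢ y → proj₁ (to (x , x∈)) ≢ proj₁ (to (y , y∈))
  to-≢ x∈ y∈ x≢y e = x≢y (cong proj₁ (trans (sym (Inverse.strictlyInverseʳ bij _))
    (trans (cong from (Vertex-≡ {G = Q} e)) (Inverse.strictlyInverseʳ bij _))))

  ¬to-adj : ∀ {x y} (x∈ : x ∈ V H) (y∈ : y ∈ V H) → ¬ Adj H x y →
    ¬ Adj Q (proj₁ (to (x , x∈))) (proj₁ (to (y , y∈)))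
  ¬to-adj x∈ y∈ ¬xy = ¬xy ∘ Equivalence.from (pres _ _)

  from-surjective : ∀ {v} (v∈ : v ∈ V H) → v ≡ from-vertex (proj₂ (to (v , v∈)))
  from-surjective v∈ = sym (cong proj₁ (Inverse.strictlyInverseʳ bij (_ , v∈)))

≅K⇒complete : {H : Graph n} → H ≅ K m → ∃[ f ] (∀ {i j} → i ≢ j → Adj H (f i) (f j)) ×
  (∀ i → f i ∈ V H) × (∀ {v} → v ∈ V H → ∃[ i ] v ≡ f i)
≅K⇒complete {m = m} iso = f ,
  (λ {i} {j} i≢j → from-adj iso ∈⊤ ∈⊤ (x∉p⇒x∈∁p (i≢j ∘ sym ∘ x∈⁅y⁆⇒x≡y i))) ,
  (λ i → from-∈V iso ∈⊤) ,
  λ v∈ → _ , trans (from-surjective iso v∈) (cong (λ p → from-vertex iso p) ([]=-irrelevant _ ∈⊤))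
  where
  f : Fin m → Fin _
  f i = from-vertex iso {i} ∈⊤

-- Classification of squeezed triangles

module _ (H : Graph n) where

  -- In the classification this case means that H is the diamond. The isomorphism is not built:
  -- these facts about the second tip `d` suffice to refute the case.
  DiamondTip : (a b c d : Fin n) → Set
  DiamondTip a b c d = Adj H b c × Adj H b d × Adj H c d × a ≢ d ×
    ¬ Adj H a d × (∀ {x} → Adj H d x → x ∈ˡ b ∷ c ∷ [])

  data Classified (ts : List (Fin n)) : Set where
    pendant  : ∀ {a b c ns r} → ts ↭ a ∷ b ∷ c ∷ [] → Pendant H a b c ns r → Classified ts
    complete : H ≅ K 3 ⊎ H ≅ K 4 → Classified ts
    diamond  : ∀ {a b c d} → ts ↭ a ∷ b ∷ c ∷ [] → DiamondTip a b c d → Classified ts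

  classified-↭ : ∀ {ts ts′} → ts ↭ ts′ → Classified ts′ → Classified ts
  classified-↭ p (pendant q t)  = pendant (↭-trans p q) t
  classified-↭ p (complete iso) = complete iso
  classified-↭ p (diamond q t)  = diamond (↭-trans p q) t

  private
    drop-self : ∀ {a b c x} → Adj H a x → x ∈ˡ a ∷ b ∷ c ∷ [] → x ∈ˡ b ∷ c ∷ []
    drop-self ax 1st        = contradiction refl (Adj⇒≢ H ax)
    drop-self _  (there x∈) = x∈

  one-exit : ∀ {a b c x} → IsTriangle H a b c →
    (∀ {y} → Adj H a y → y ∈ˡ a ∷ b ∷ c ∷ []) → (∀ {y} → Adj H b y → y ∈ˡ a ∷ b ∷ c ∷ []) →
    Adj H c x → x ∉ˡ a ∷ b ∷ c ∷ [] → PendantTriangle H a b c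
  one-exit {a} {b} {c} t@(ab , ac , bc) Na Nb cx x∉ = t ,
    ∣p∣≡length (N H a) (Unique₂ (Adj⇒≢ H bc)) (λ { 1st → ab ; 2nd → ac }) (λ ay → drop-self ay (Na ay)) ,
    ∣p∣≡length (N H b) (Unique₂ (Adj⇒≢ H ac)) (λ { 1st → N-sym H ab ; 2nd → bc })
      (λ by → drop-self by (∈-resp-↭ (swap a b ↭-refl) (Nb by))) ,
    length≤∣p∣ (N H c) (Unique₃ (Adj⇒≢ H ab) (λ a≡x → x∉ (here (sym a≡x))) (λ b≡x → x∉ (there (here (sym b≡x)))))
      (λ { 1st → N-sym H ac ; 2nd → N-sym H bc ; 3rd → cx })

  two-exits : ∀ {a b c x} → IsTriangle H a b c → (∀ {y} → Adj H a y → y ∈ˡ a ∷ b ∷ c ∷ []) →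
    x ∉ˡ a ∷ b ∷ c ∷ [] → Adj H b x → Adj H c x →
    (∀ {p y} → p ∈ˡ a ∷ b ∷ c ∷ [] → Adj H p y → y ∉ˡ a ∷ b ∷ c ∷ [] → y ≡ x) →
    Classified (a ∷ b ∷ c ∷ [])
  two-exits {a} {b} {c} {x} t@(ab , ac , bc) Na x∉ bx cx exit with 3 ℕ.≤? deg H x
  ... | yes 3≤ = pendant ↭-refl (dia ((ab , ac , bc , bx , cx , (λ a≡x → x∉ (here (sym a≡x))) , x∉ ∘ Na) ,
    ∣p∣≡length (N H a) (Unique₂ (Adj⇒≢ H bc)) (λ { 1st → ab ; 2nd → ac }) (λ ay → drop-self ay (Na ay)) ,
    ∣p∣≡length (N H b) (Unique₃ (Adj⇒≢ H ac) (x∉ ∘ here ∘ sym) (Adj⇒≢ H cx))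
      (λ { 1st → N-sym H ab ; 2nd → bc ; 3rd → bx }) Nb ,
    ∣p∣≡length (N H c) (Unique₃ (Adj⇒≢ H ab) (x∉ ∘ here ∘ sym) (Adj⇒≢ H bx))
      (λ { 1st → N-sym H ac ; 2nd → N-sym H bc ; 3rd → cx }) Nc , 3≤))
    where
    Nb : ∀ {y} → Adj H b y → y ∈ˡ a ∷ c ∷ x ∷ []
    Nb {y} by with y ∈ˡ? a ∷ b ∷ c ∷ []
    ... | yes 1st = 1st
    ... | yes 2nd = contradiction refl (Adj⇒≢ H by)
    ... | yes 3rd = 2nd
    ... | no  y∉  = there (there (here (exit 2nd by y∉)))
    Nc : ∀ {y} → Adj H c y → y ∈ˡ a ∷ b ∷ x ∷ []
    Nc {y} cy with y ∈ˡ? a ∷ b ∷ c ∷ []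
    ... | yes 1st = 1st
    ... | yes 2nd = 2nd
    ... | yes 3rd = contradiction refl (Adj⇒≢ H cy)
    ... | no  y∉  = there (there (here (exit 3rd cy y∉)))
  ... | no ¬3≤ = diamond ↭-refl (bc , bx , cx , (x∉ ∘ here ∘ sym) , x∉ ∘ Na ,
    ∣p∣≤length⇒p⊆ (N H x) (Unique₂ (Adj⇒≢ H bc)) (λ { 1st → N-sym H bx ; 2nd → N-sym H cx })
      (ℕ.≤-pred (ℕ.≰⇒> ¬3≤)))

  module _ (conn : Connected H) where

    isolated-triangle : ∀ {a b c} → IsTriangle H a b c →
      (∀ {p x} → p ∈ˡ a ∷ b ∷ c ∷ [] → Adj H p x → x ∈ˡ a ∷ b ∷ c ∷ []) → H ≅ K 3
    isolated-triangle {a} {b} {c} (ab , ac , bc) stays =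
      complete⇒≅K H (a ∷ b ∷ c ∷ [])
        (λ { 1st → N⊆V H (N-sym H ab) ; 2nd → N⊆V H ab ; 3rd → N⊆V H ac })
        ((ab ∷ᵃ ac ∷ᵃ []ᵃ) ∷ (bc ∷ᵃ []ᵃ) ∷ []ᵃ ∷ [])
        (connected-⊆ H conn (_∈ˡ a ∷ b ∷ c ∷ []) (N⊆V H (N-sym H ab)) 1st stays)

    isolated-K₄ : ∀ {a b c d} → InducesK₄ H a b c d →
      (∀ {p x} → p ∈ˡ a ∷ b ∷ c ∷ d ∷ [] → Adj H p x → x ∈ˡ a ∷ b ∷ c ∷ d ∷ []) → H ≅ K 4
    isolated-K₄ {a} {b} {c} {d} (ab , ac , ad , bc , bd , cd) stays =
      complete⇒≅K H (a ∷ b ∷ c ∷ d ∷ [])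
        (λ { 1st → N⊆V H (N-sym H ab) ; 2nd → N⊆V H ab ; 3rd → N⊆V H ac ; (there 3rd) → N⊆V H ad })
        ((ab ∷ᵃ ac ∷ᵃ ad ∷ᵃ []ᵃ) ∷ (bc ∷ᵃ bd ∷ᵃ []ᵃ) ∷ (cd ∷ᵃ []ᵃ) ∷ []ᵃ ∷ [])
        (connected-⊆ H conn (_∈ˡ a ∷ b ∷ c ∷ d ∷ []) (N⊆V H (N-sym H ab)) 1st stays)

    three-exits : ∀ {a b c x} → IsTriangle H a b c →
      x ∉ˡ a ∷ b ∷ c ∷ [] → Adj H a x → Adj H b x → Adj H c x →
      (∀ {p y} → p ∈ˡ a ∷ b ∷ c ∷ [] → Adj H p y → y ∉ˡ a ∷ b ∷ c ∷ [] → y ≡ x) →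
      Classified (a ∷ b ∷ c ∷ [])
    three-exits {a} {b} {c} {x} (ab , ac , bc) x∉ ax bx cx exit = by-degree (4 ℕ.≤? deg H x)
      where
      reach : ∀ {p y} → p ∈ˡ a ∷ b ∷ c ∷ [] → Adj H p y → y ∈ˡ a ∷ b ∷ c ∷ x ∷ []
      reach {p} {y} p∈ py with y ∈ˡ? a ∷ b ∷ c ∷ []
      ... | yes 1st = 1st
      ... | yes 2nd = 2nd
      ... | yes 3rd = 3rd
      ... | no  y∉  = there (there (there (here (exit p∈ py y∉))))
      others : ∀ {p q r s y} → Adj H p y → y ∈ˡ p ∷ q ∷ r ∷ s ∷ [] → y ∈ˡ q ∷ r ∷ s ∷ []
      others py 1st        = contradiction refl (Adj⇒≢ H py)
      others _  (there y∈) = y∈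
      stays : deg H x ≤ 3 → ∀ {p y} → p ∈ˡ a ∷ b ∷ c ∷ x ∷ [] → Adj H p y → y ∈ˡ a ∷ b ∷ c ∷ x ∷ []
      stays _ 1st py = reach 1st py
      stays _ 2nd py = reach 2nd py
      stays _ 3rd py = reach 3rd py
      stays ≤3 (there 3rd) xy with ∣p∣≤length⇒p⊆ (N H x)
        (Unique₃ (Adj⇒≢ H ab) (Adj⇒≢ H ac) (Adj⇒≢ H bc))
        (λ { 1st → N-sym H ax ; 2nd → N-sym H bx ; 3rd → N-sym H cx }) ≤3 xy
      ... | 1st = 1st
      ... | 2nd = 2nd
      ... | 3rd = 3rd
      by-degree : Dec (4 ≤ deg H x) → Classified (a ∷ b ∷ c ∷ [])
      by-degree (yes 4≤) = pendant ↭-refl (k₄ ((ab , ac , ax , bc , bx , cx) ,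
        ∣p∣≡length (N H a) (Unique₃ (Adj⇒≢ H bc) (Adj⇒≢ H bx) (Adj⇒≢ H cx))
          (λ { 1st → ab ; 2nd → ac ; 3rd → ax }) (λ ay → others ay (reach 1st ay)) ,
        ∣p∣≡length (N H b) (Unique₃ (Adj⇒≢ H ac) (Adj⇒≢ H ax) (Adj⇒≢ H cx))
          (λ { 1st → N-sym H ab ; 2nd → bc ; 3rd → bx })
          (λ by → others by (∈-resp-↭ (swap a b ↭-refl) (reach 2nd by))) ,
        ∣p∣≡length (N H c) (Unique₃ (Adj⇒≢ H ab) (Adj⇒≢ H ax) (Adj⇒≢ H bx))
          (λ { 1st → N-sym H ac ; 2nd → N-sym H bc ; 3rd → cx })
          (λ cy → others cy (∈-resp-↭ (↭-trans (prep a (swap b c ↭-refl)) (swap a c ↭-refl)) (reach 3rd cy))) ,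
        4≤))
      by-degree (no ¬4≤) = complete (inj₂ (isolated-K₄ (ab , ac , ax , bc , bx , cx)
        (stays (ℕ.≤-pred (ℕ.≰⇒> ¬4≤)))))

    -- The cases are the sets of corners with a neighbour outside. Without any, connectedness gives
    -- the complete graph on the triangle, and one such corner is the root of a pendant triangle.
    -- With two or three, squeezedness makes all exits lead to one vertex, and its degree decides
    -- between the root of a pendant subgraph and a graph that ends there.
    classify : ∀ {a b c} → IsTriangle H a b c → Squeezed H (a ∷ b ∷ c ∷ []) → Classified (a ∷ b ∷ c ∷ [])
    classify {a} {b} {c} t@(ab , ac , bc) sq = by-exits (exit? a) (exit? b) (exit? c)
      where
      ts = a ∷ b ∷ c ∷ []
      Exit : Fin n → Set
      Exit p = ∃[ x ] Adj H p x × x ∉ˡ ts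
      exit? : ∀ p → Dec (Exit p)
      exit? p = any? λ x → adj? H p x ×-dec ¬? (x ∈ˡ? ts)
      stay : ∀ {p} → ¬ Exit p → ∀ {x} → Adj H p x → x ∈ˡ ts
      stay {p} ¬exit {x} px with x ∈ˡ? ts
      ... | yes x∈ = x∈
      ... | no  x∉ = contradiction (x , px , x∉) ¬exit
      -- Squeezedness only compares different corners, so r is compared with whichever of p and q it
      -- differs from.
      same : ∀ {p q x} → p ∈ˡ ts → q ∈ˡ ts → p ≢ q → Adj H p x → Adj H q x → x ∉ˡ ts →
        ∀ {r y} → r ∈ˡ ts → Adj H r y → y ∉ˡ ts → y ≡ x
      same {p} p∈ q∈ p≢q px qx x∉ {r} r∈ ry y∉ with r ≟ p
      ... | no  r≢p  = sq r∈ p∈ r≢p ry y∉ px x∉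
      ... | yes refl = sq r∈ q∈ p≢q ry y∉ qx x∉
      bac : ts ↭ b ∷ a ∷ c ∷ []
      bac = swap a b ↭-refl
      acb : ts ↭ a ∷ c ∷ b ∷ []
      acb = prep a (swap b c ↭-refl)
      cab : ts ↭ c ∷ a ∷ b ∷ []
      cab = ↭-trans acb (swap a c ↭-refl)
      bca : ts ↭ b ∷ c ∷ a ∷ []
      bca = ↭-trans bac (prep b (swap a c ↭-refl))
      by-exits : Dec (Exit a) → Dec (Exit b) → Dec (Exit c) → Classified ts
      by-exits (no ¬a) (no ¬b) (no ¬c) = complete (inj₁ (isolated-triangle t
        λ { 1st → stay ¬a ; 2nd → stay ¬b ; 3rd → stay ¬c }))
      by-exits (no ¬a) (no ¬b) (yes (x , cx , x∉)) = pendant ↭-refl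
        (tri (one-exit t (stay ¬a) (stay ¬b) cx x∉))
      by-exits (no ¬a) (yes (x , bx , x∉)) (no ¬c) = pendant acb
        (tri (one-exit (ac , ab , N-sym H bc) (∈-resp-↭ acb ∘ stay ¬a) (∈-resp-↭ acb ∘ stay ¬c)
          bx (x∉ ∘ ∈-resp-↭ (↭-sym acb))))
      by-exits (yes (x , ax , x∉)) (no ¬b) (no ¬c) = pendant bca
        (tri (one-exit (bc , N-sym H ab , N-sym H ac) (∈-resp-↭ bca ∘ stay ¬b) (∈-resp-↭ bca ∘ stay ¬c)
          ax (x∉ ∘ ∈-resp-↭ (↭-sym bca))))
      by-exits (no ¬a) (yes (x , bx , x∉)) (yes (y , cy , y∉))
        with refl ← sq 2nd 3rd (Adj⇒≢ H bc) bx x∉ cy y∉ =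
        two-exits t (stay ¬a) x∉ bx cy (same 2nd 3rd (Adj⇒≢ H bc) bx cy x∉)
      by-exits (yes (x , ax , x∉)) (no ¬b) (yes (y , cy , y∉))
        with refl ← sq 1st 3rd (Adj⇒≢ H ac) ax x∉ cy y∉ = classified-↭ bac
        (two-exits (N-sym H ab , bc , ac) (∈-resp-↭ bac ∘ stay ¬b) (x∉ ∘ ∈-resp-↭ (↭-sym bac)) ax cy
          λ p∈ py y∉ → same 1st 3rd (Adj⇒≢ H ac) ax cy x∉ (∈-resp-↭ (↭-sym bac) p∈) py
            (y∉ ∘ ∈-resp-↭ bac))
      by-exits (yes (x , ax , x∉)) (yes (y , by , y∉)) (no ¬c)
        with refl ← sq 1st 2nd (Adj⇒≢ H ab) ax x∉ by y∉ = classified-↭ cab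
        (two-exits (N-sym H ac , N-sym H bc , ab) (∈-resp-↭ cab ∘ stay ¬c) (x∉ ∘ ∈-resp-↭ (↭-sym cab)) ax by
          λ p∈ py y∉ → same 1st 2nd (Adj⇒≢ H ab) ax by x∉ (∈-resp-↭ (↭-sym cab) p∈) py
            (y∉ ∘ ∈-resp-↭ cab))
      by-exits (yes (x , ax , x∉)) (yes (y , by , y∉)) (yes (z , cz , z∉))
        with refl ← sq 1st 2nd (Adj⇒≢ H ab) ax x∉ by y∉
           | refl ← sq 1st 3rd (Adj⇒≢ H ac) ax x∉ cz z∉ =
        three-exits t x∉ ax by cz (same 1st 2nd (Adj⇒≢ H ab) ax by x∉)

-- Deleting vertices

-- Proofs about the reduction assume this interface for an abstract `F`, which keeps the decision
-- procedures behind `induced` out of their goals.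
record Induces (G : Graph n) (P : Fin n → Set) (F : Graph n) : Set where
  field
    adj⁺ : ∀ {u v} → P u → P v → Adj G u v → Adj F u v
    adj⁻ : ∀ {u v} → Adj F u v → P u × P v × Adj G u v
    V⁺   : ∀ {v} → v ∈ V G → P v → v ∈ V F
    V⁻   : ∀ {v} → v ∈ V F → v ∈ V G × P v

  E⊆E : E F ⊆ E G
  E⊆E e∈ with E-at F e∈ (inj₁ refl)
  ... | v , a , e≡ = subst (_∈ E G) (sym e≡) (edge∈E G (proj₂ (proj₂ (adj⁻ a))))

∖-induces : (G : Graph n) (X : Subset n) → Induces G (_∉ X) (G ∖ X)
∖-induces G X = record
  { adj⁺ = λ {u} u∉ v∉ uv → ∈-sep⁺ (inducedAdj? G (∁ X) u) (x∉p⇒x∈∁p u∉ , x∉p⇒x∈∁p v∉ , uv)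
  ; adj⁻ = λ {u} uv → let u∈ , v∈ , a = ∈-sep⁻ (inducedAdj? G (∁ X) u) uv in
      x∈∁p⇒x∉p u∈ , x∈∁p⇒x∉p v∈ , a
  ; V⁺   = λ v∈ v∉ → x∈p∩q⁺ (v∈ , x∉p⇒x∈∁p v∉)
  ; V⁻   = λ v∈ → let v∈V , v∈∁ = x∈p∩q⁻ (V G) (∁ X) v∈ in v∈V , x∈∁p⇒x∉p v∈∁
  }

∖-sep-induces : (G : Graph n) {P : Fin n → Set} (P? : ∀ v → Dec (P v)) →
  Induces G (λ v → ¬ P v) (G ∖ sep P?)
∖-sep-induces G P? = record
  { adj⁺ = λ ¬u ¬v → adj⁺ (¬u ∘ ∈-sep⁻ P?) (¬v ∘ ∈-sep⁻ P?)
  ; adj⁻ = λ uv → let u∉ , v∉ , a = adj⁻ uv in u∉ ∘ ∈-sep⁺ P? , v∉ ∘ ∈-sep⁺ P? , a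
  ; V⁺   = λ v∈ ¬v → V⁺ v∈ (¬v ∘ ∈-sep⁻ P?)
  ; V⁻   = λ v∈ → let v∈V , v∉ = V⁻ v∈ in v∈V , v∉ ∘ ∈-sep⁺ P?
  }
  where open Induces (∖-induces G (sep P?))

module _ (H : Graph n) where

  R△? : ∀ c → Dec (∃[ a ] ∃[ b ] PendantTriangle H a b c)
  R△? c = any? λ a → any? λ b → pendantTriangle? H a b c

  R◇? : ∀ d → Dec (∃[ a ] ∃[ b ] ∃[ c ] PendantDiamond H a b c d)
  R◇? d = any? λ a → any? λ b → any? λ c → pendantDiamond? H a b c d

  RK₄? : ∀ d → Dec (∃[ a ] ∃[ b ] ∃[ c ] PendantK₄ H a b c d)
  RK₄? d = any? λ a → any? λ b → any? λ c → pendantK₄? H a b c d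

  root∈V : ∀ {a b c ns r} → Pendant H a b c ns r → r ∈ V H
  root∈V (tri ((_ , ac , _) , _))              = N⊆V H ac
  root∈V (dia ((_ , _ , _ , bd , _) , _))      = N⊆V H bd
  root∈V (k₄ ((_ , _ , ad , _) , _))           = N⊆V H ad

  reduction-connected : ∀ {F} → Induces H (λ v → ¬ NonRoot H v) F → Connected H → Connected F
  reduction-connected {F} ind ((v , v∈) , path) = nonempty , λ u∈ w∈ →
    from-kept (proj₂ (V⁻ w∈)) (path (proj₁ (V⁻ u∈)) (proj₁ (V⁻ w∈))) (proj₂ (V⁻ u∈))
    where
    open Induces ind
    nonempty : Nonempty (V F)
    nonempty with nonRoot? H v
    ... | no ¬v = v , V⁺ v∈ ¬v
    ... | yes nr with nonRoot⁻ H nr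
    ... | _ , _ , _ , _ , r , p , _ = r , V⁺ (root∈V p) (root-¬nonRoot H p)
    -- A walk of H is projected to F by sending every pendant subgraph to its root.
    from-kept : ∀ {x w} → ¬ NonRoot H w → Star (Adj H) x w → ¬ NonRoot H x → Star (Adj F) x w
    from-pendant : ∀ {a b c ns r x w} → ¬ NonRoot H w → Star (Adj H) x w →
      Pendant H a b c ns r → x ∈ˡ ns → Star (Adj F) r w
    from-kept ¬w ε _ = ε
    from-kept ¬w (_◅_ {j = y} xy s) ¬x with nonRoot? H y
    ... | no ¬y = adj⁺ ¬x ¬y xy ◅ from-kept ¬w s ¬y
    ... | yes nr with nonRoot⁻ H nr
    ... | _ , _ , _ , _ , _ , p , y∈ with closed H p y∈ (N-sym H xy)
    ... | inj₁ x∈   = contradiction (nonRoot⁺ H p x∈) ¬x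
    ... | inj₂ refl = from-pendant ¬w s p y∈
    from-pendant ¬w ε p x∈ = contradiction (nonRoot⁺ H p x∈) ¬w
    from-pendant ¬w (xy ◅ s) p x∈ with closed H p x∈ xy
    ... | inj₁ y∈   = from-pendant ¬w s p y∈
    ... | inj₂ refl = from-kept ¬w s (root-¬nonRoot H p)

  -- Sufficiency

  -- Parity: a, b and c are covered but cannot be matched among themselves, so one of them is
  -- matched to d.
  K₄-triple-forces : ∀ {a b c d} → Adj H d a → Adj H d b → Adj H d c →
    (∀ {x} → Adj H a x → x ∈ˡ b ∷ c ∷ d ∷ []) → (∀ {x} → Adj H b x → x ∈ˡ a ∷ c ∷ d ∷ []) →
    (∀ {x} → Adj H c x → x ∈ˡ a ∷ b ∷ d ∷ []) → a ≢ b → a ≢ c → b ≢ c → Forced H d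
  K₄-triple-forces {a} {b} {c} {d} da db dc Na Nb Nc a≢b a≢c b≢c {M} mM@(M⊆E , _) nbrs
    with covers-at H M⊆E (nbrs da) | covers-at H M⊆E (nbrs db) | covers-at H M⊆E (nbrs dc)
  ... | x , ax , ax∈ | y , by , by∈ | z , cz , cz∈ with Na ax | Nb by | Nc cz
  ... | 3rd | _   | _   = _ , ax∈ , incident₂ a d
  ... | _   | 3rd | _   = _ , by∈ , incident₂ b d
  ... | _   | _   | 3rd = _ , cz∈ , incident₂ c d
  ... | 1st | 2nd | _   = contradiction (matching-unique H mM (edge∈-comm H ax∈) by∈) a≢c
  ... | 1st | 1st | 1st = contradiction (matching-unique H mM ax∈ (edge∈-comm H cz∈)) b≢c
  ... | 1st | 1st | 2nd = contradiction (matching-unique H mM by∈ (edge∈-comm H cz∈)) a≢c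
  ... | 2nd | 1st | _   = contradiction (matching-unique H mM ax∈ (edge∈-comm H by∈)) (b≢c ∘ sym)
  ... | 2nd | 2nd | _   = contradiction (matching-unique H mM (edge∈-comm H ax∈) (edge∈-comm H by∈)) a≢b

  module _ {F : Graph n} (ind : Induces H (λ v → ¬ NonRoot H v) F)
    {U W : Subset n} (bip : IsBipartition F U W) (roots⊆U : R◇ H ∪ RK₄ H ⊆ U) (R△⊆W : R△ H ⊆ W)
    (strongU : ∀ u → u ∈ U ─ RK₄ H → IsStrongVertex (F ∖ (N F u ∩ R△ H)) u) where

    open IsBipartition bip
    open Induces ind using () renaming (adj⁺ to F-adj⁺; adj⁻ to F-adj⁻; V⁺ to F-V⁺; V⁻ to F-V⁻)

    private
      U⊆F : U ⊆ V F
      U⊆F = proj₁ indepU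

      U∩W : ∀ {x} → x ∈ U → x ∉ W
      U∩W x∈U x∈W = disjoint (_ , x∈p∩q⁺ (x∈U , x∈W))

      dia-root : ∀ {a b c d} → PendantDiamond H a b c d → d ∈ U
      dia-root p = roots⊆U (x∈p∪q⁺ (inj₁ (∈-sep⁺ R◇? (_ , _ , _ , p))))

      k₄-root : ∀ {a b c d} → PendantK₄ H a b c d → d ∈ U
      k₄-root p = roots⊆U (x∈p∪q⁺ (inj₂ (∈-sep⁺ RK₄? (_ , _ , _ , p))))

      tri-root : ∀ {a b c} → PendantTriangle H a b c → c ∈ W
      tri-root p = R△⊆W (∈-sep⁺ R△? (_ , _ , p))

      neighbour∈W : ∀ {u x} → u ∈ U → Adj F u x → x ∈ W
      neighbour∈W u∈ ux with x∈p∪q⁻ U W (subst (_ ∈_) (sym cover) (N⊆V F ux))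
      ... | inj₁ x∈U = contradiction ux (proj₂ indepU u∈ x∈U)
      ... | inj₂ x∈W = x∈W

      -- A deleted neighbour y would make x the root of a pendant subgraph. Triangles are excluded
      -- by assumption, and roots of diamonds and K4s lie in `U`, which has no edge to u.
      kept-neighbour : ∀ {u x y} → u ∈ U → Adj F u x → x ∉ R△ H → Adj H x y → Adj F x y
      kept-neighbour {u} {x} {y} u∈ ux x∉ xy with nonRoot? H y
      ... | no ¬y = F-adj⁺ (proj₁ (proj₂ (F-adj⁻ ux))) ¬y xy
      ... | yes nr with nonRoot⁻ H nr
      ... | _ , _ , _ , _ , _ , p , y∈ with closed H p y∈ (N-sym H xy)
      ... | inj₁ x∈ns = contradiction (nonRoot⁺ H p x∈ns) (proj₁ (proj₂ (F-adj⁻ ux)))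
      ... | inj₂ refl with p
      ... | tri t = contradiction (∈-sep⁺ R△? (_ , _ , t)) x∉
      ... | dia t = contradiction ux (proj₂ indepU u∈ (dia-root t))
      ... | k₄ t  = contradiction ux (proj₂ indepU u∈ (k₄-root t))

      -- Roots of a K4 are forced by parity. For any other u, a matching of H that covers the
      -- neighbours of u is cut down to F - X. No neighbour of u in F - X loses its matching edge,
      -- because that edge lies in F by `kept-neighbour`.
      forcedU : ∀ {u} → u ∈ U → Forced H u
      forcedU {u} u∈ with RK₄? u
      ... | yes (a , b , c , p@((ab , ac , ad , bc , bd , cd) , _)) =
        K₄-triple-forces (N-sym H ad) (N-sym H bd) (N-sym H cd) (K₄-N H p)
          (K₄-N H (K₄-swap H p)) (K₄-N H (K₄-rotate H (K₄-rotate H p)))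
          (Adj⇒≢ H ab) (Adj⇒≢ H ac) (Adj⇒≢ H bc)
      ... | no ¬p = forced
        where
        X  = N F u ∩ R△ H
        F′ = F ∖ X
        ind′ = ∖-induces F X
        forced : Forced H u
        forced {M} mM@(M⊆E , disj) nbrs =
          let e , e∈ , ue = strong⇒forced F′ (strongU u (x∈p∧x∉q⇒x∈p─q u∈ (¬p ∘ ∈-sep⁻ RK₄?)))
                mM′ nbrs′
          in e , proj₁ (x∈p∩q⁻ M (E F′) e∈) , ue
          where
          M′ = M ∩ E F′
          mM′ : IsMatching F′ M′
          mM′ = p∩q⊆q M (E F′) , λ e∈ f∈ → disj (p∩q⊆p M (E F′) e∈) (p∩q⊆p M (E F′) f∈)
          nbrs′ : ∀ {x} → Adj F′ u x → Covers F′ M′ x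
          nbrs′ {x} ux with Induces.adj⁻ ind′ ux
          ... | u∉X , x∉X , uxF with covers-at H M⊆E (nbrs (proj₂ (proj₂ (F-adj⁻ uxF))))
          ... | y , xy , xy∈ = edge x y ,
            x∈p∩q⁺ (xy∈ , edge∈E F′ (Induces.adj⁺ ind′ x∉X y∉X xyF)) , incident₁ x y
            where
            xyF : Adj F x y
            xyF = kept-neighbour u∈ uxF (λ x∈△ → x∉X (x∈p∩q⁺ (uxF , x∈△))) xy
            -- Both x and the elements of X are neighbours of u, so they lie in the independent set
            -- `W`.
            y∉X : y ∉ X
            y∉X y∈X = proj₂ indepW (neighbour∈W u∈ uxF)
              (neighbour∈W u∈ (p∩q⊆p (N F u) (R△ H) y∈X)) xyF

    -- The pieces are the stars at `U` and all pendant triples. The edges from a root to the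
    -- non-roots of its diamond or K4 belong to the star of the root; a pendant triangle is a piece
    -- by itself, its root being in `W`.
    bipartition⇒localizable : Localizable (L H)
    bipartition⇒localizable = decomposition⇒localizable H (isPendantTriple? H) record
      { strong   = λ u∈ → forced⇒strong H (proj₁ (F-V⁻ (U⊆F u∈))) (forcedU u∈)
      ; indep    = λ u∈ v∈ uv → proj₂ indepU u∈ v∈
          (F-adj⁺ (proj₂ (F-V⁻ (U⊆F u∈))) (proj₂ (F-V⁻ (U⊆F v∈))) uv)
      ; triangle = λ (_ , _ , p) → pendant-triangle H p
      ; squeezed = λ (_ , _ , p) → pendant-squeezed H p
      ; avoids   = avoids
      ; T-unique = λ (_ , _ , p) (_ , _ , p′) → pendant-unique H p p′
      ; cover    = cover′
      }
      where
      avoids : ∀ {a b c x} → IsPendantTriple H a b c → x ∈ˡ a ∷ b ∷ c ∷ [] → x ∉ U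
      avoids (_ , _ , p) x∈ x∈U with corners⊆nonRoots H p x∈
      ... | inj₁ x∈ns = proj₂ (F-V⁻ (U⊆F x∈U)) (nonRoot⁺ H p x∈ns)
      ... | inj₂ refl = U∩W x∈U (tri-root (proj₂ (corner-root H p x∈)))
      InTriple : (x y : Fin n) → Set
      InTriple x y = ∃[ a ] ∃[ b ] ∃[ c ] IsPendantTriple H a b c ×
        x ∈ˡ a ∷ b ∷ c ∷ [] × y ∈ˡ a ∷ b ∷ c ∷ []
      at-nonRoot : ∀ {x y} → NonRoot H x → Adj H x y → y ∈ U ⊎ InTriple x y
      at-nonRoot nr xy with nonRoot⁻ H nr
      ... | _ , _ , _ , _ , _ , p , x∈ with closed H p x∈ xy
      ... | inj₁ y∈ = inj₂ (_ , _ , _ , (_ , _ , p) , nonRoots⊆corners H p x∈ , nonRoots⊆corners H p y∈)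
      ... | inj₂ refl with p
      ... | tri t = inj₂ (_ , _ , _ , (_ , _ , p) , nonRoots⊆corners H p x∈ , 3rd)
      ... | dia t = inj₁ (dia-root t)
      ... | k₄ t  = inj₁ (k₄-root t)
      cover′ : ∀ {x y} → Adj H x y → x ∈ U ⊎ y ∈ U ⊎ InTriple x y
      cover′ {x} {y} xy with nonRoot? H x | nonRoot? H y
      ... | yes nr | _ = inj₂ (at-nonRoot nr xy)
      ... | no _ | yes nr with at-nonRoot nr (N-sym H xy)
      ... | inj₁ x∈U = inj₁ x∈U
      ... | inj₂ (a , b , c , t , y∈ , x∈) = inj₂ (inj₂ (a , b , c , t , x∈ , y∈))
      cover′ {x} {y} xy | no ¬x | no ¬y
        with x∈p∪q⁻ U W (subst (x ∈_) (sym cover) (F-V⁺ (N⊆V H (N-sym H xy)) ¬x))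
      ... | inj₁ x∈U = inj₁ x∈U
      ... | inj₂ x∈W with x∈p∪q⁻ U W (subst (y ∈_) (sym cover) (F-V⁺ (N⊆V H xy) ¬y))
      ... | inj₁ y∈U = inj₂ (inj₁ y∈U)
      ... | inj₂ y∈W = contradiction (F-adj⁺ ¬x ¬y xy) (proj₂ indepW x∈W y∈W)

  K₃⇒localizable : H ≅ K 3 → Localizable (L H)
  K₃⇒localizable iso with ≅K⇒complete iso
  ... | f , adj , _ , onto = decomposition⇒localizable H
    (λ a b c → (a ≟ f 0F) ×-dec (b ≟ f 1F) ×-dec (c ≟ f 2F)) record
      { strong   = λ u∈ → contradiction u∈ ∉⊥
      ; indep    = λ u∈ → contradiction u∈ ∉⊥
      ; triangle = λ { (refl , refl , refl) → adj (λ ()) , adj (λ ()) , adj λ () }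
      ; squeezed = λ { (refl , refl , refl) _ _ _ px x∉ _ _ → contradiction (all∈ px) x∉ }
      ; avoids   = λ _ _ → ∉⊥
      ; T-unique = λ { (refl , refl , refl) (refl , refl , refl) _ _ _ _ _ z∈ → z∈ }
      ; cover    = λ xy → inj₂ (inj₂ (_ , _ , _ , (refl , refl , refl) , all∈ (N-sym H xy) , all∈ xy))
      }
    where
    all∈ : ∀ {u v} → Adj H u v → v ∈ˡ f 0F ∷ f 1F ∷ f 2F ∷ []
    all∈ uv with onto (N⊆V H uv)
    ... | 0F , refl = 1st
    ... | 1F , refl = 2nd
    ... | 2F , refl = 3rd

  -- The pieces are the star of one vertex d, strong by parity, and the opposite triangle, whose
  -- exits all lead to d.
  K₄⇒localizable : H ≅ K 4 → Localizable (L H)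
  K₄⇒localizable iso with ≅K⇒complete iso
  ... | f , adj , f∈V , onto = decomposition⇒localizable H {S = ⁅ d ⁆}
    (λ x y z → (x ≟ a) ×-dec (y ≟ b) ×-dec (z ≟ c)) record
      { strong   = λ u∈ → subst (IsStrongVertex H) (sym (x∈⁅y⁆⇒x≡y d u∈)) d-strong
      ; indep    = λ u∈ v∈ uv → Adj⇒≢ H uv (trans (x∈⁅y⁆⇒x≡y d u∈) (sym (x∈⁅y⁆⇒x≡y d v∈)))
      ; triangle = λ { (refl , refl , refl) → adj (λ ()) , adj (λ ()) , adj λ () }
      ; squeezed = λ { (refl , refl , refl) _ _ _ px x∉ qy y∉ → trans (≡d px x∉) (sym (≡d qy y∉)) }
      ; avoids   = λ { (refl , refl , refl) x∈ x∈S → d∉ (subst (_∈ˡ _) (x∈⁅y⁆⇒x≡y d x∈S) x∈) }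
      ; T-unique = λ { (refl , refl , refl) (refl , refl , refl) _ _ _ _ _ z∈ → z∈ }
      ; cover    = cover
      }
    where
    a = f 0F
    b = f 1F
    c = f 2F
    d = f 3F
    d∉ : d ∉ˡ a ∷ b ∷ c ∷ []
    d∉ (here d≡a)                 = Adj⇒≢ H (adj λ ()) d≡a
    d∉ (there (here d≡b))         = Adj⇒≢ H (adj λ ()) d≡b
    d∉ (there (there (here d≡c))) = Adj⇒≢ H (adj λ ()) d≡c
    corner? : ∀ {v} → v ∈ V H → v ≡ d ⊎ v ∈ˡ a ∷ b ∷ c ∷ []
    corner? v∈ with onto v∈
    ... | 0F , refl = inj₂ 1st
    ... | 1F , refl = inj₂ 2nd
    ... | 2F , refl = inj₂ 3rd
    ... | 3F , refl = inj₁ refl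
    ≡d : ∀ {p x} → Adj H p x → x ∉ˡ a ∷ b ∷ c ∷ [] → x ≡ d
    ≡d px x∉ with corner? (N⊆V H px)
    ... | inj₁ x≡d = x≡d
    ... | inj₂ x∈  = contradiction x∈ x∉
    N-a : ∀ {x} → Adj H a x → x ∈ˡ b ∷ c ∷ d ∷ []
    N-a ax with onto (N⊆V H ax)
    ... | 0F , refl = contradiction refl (Adj⇒≢ H ax)
    ... | 1F , refl = 1st
    ... | 2F , refl = 2nd
    ... | 3F , refl = 3rd
    N-b : ∀ {x} → Adj H b x → x ∈ˡ a ∷ c ∷ d ∷ []
    N-b bx with onto (N⊆V H bx)
    ... | 0F , refl = 1st
    ... | 1F , refl = contradiction refl (Adj⇒≢ H bx)
    ... | 2F , refl = 2nd
    ... | 3F , refl = 3rd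
    N-c : ∀ {x} → Adj H c x → x ∈ˡ a ∷ b ∷ d ∷ []
    N-c cx with onto (N⊆V H cx)
    ... | 0F , refl = 1st
    ... | 1F , refl = 2nd
    ... | 2F , refl = contradiction refl (Adj⇒≢ H cx)
    ... | 3F , refl = 3rd
    d-strong : IsStrongVertex H d
    d-strong = forced⇒strong H (f∈V 3F) (K₄-triple-forces (adj λ ()) (adj λ ()) (adj λ ()) N-a N-b N-c
      (Adj⇒≢ H (adj λ ())) (Adj⇒≢ H (adj λ ())) (Adj⇒≢ H (adj λ ())))
    cover : ∀ {x y} → Adj H x y → x ∈ ⁅ d ⁆ ⊎ y ∈ ⁅ d ⁆ ⊎
      (∃[ x′ ] ∃[ y′ ] ∃[ z′ ] (x′ ≡ a × y′ ≡ b × z′ ≡ c) ×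
        x ∈ˡ x′ ∷ y′ ∷ z′ ∷ [] × y ∈ˡ x′ ∷ y′ ∷ z′ ∷ [])
    cover xy with corner? (N⊆V H (N-sym H xy)) | corner? (N⊆V H xy)
    ... | inj₁ refl | _         = inj₁ (x∈⁅x⁆ d)
    ... | _         | inj₁ refl = inj₂ (inj₁ (x∈⁅x⁆ d))
    ... | inj₂ x∈   | inj₂ y∈   = inj₂ (inj₂ (a , b , c , (refl , refl , refl) , x∈ , y∈))

-- Necessity

⊎-collect : {P : Fin m → Set} {B : Set} → (∀ i → P i ⊎ B) → (∀ i → P i) ⊎ B
⊎-collect {zero}  f = inj₁ λ ()
⊎-collect {suc m} f with f zero | ⊎-collect (f ∘ suc)
... | inj₂ b | _      = inj₂ b
... | _      | inj₂ b = inj₂ b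
... | inj₁ p | inj₁ q = inj₁ λ { zero → p ; (suc i) → q i }

module _ (H : Graph n) where

  third-corner : ∀ {a b c x y} → IsTriangle H a b c → x ∈ˡ a ∷ b ∷ c ∷ [] → y ∈ˡ a ∷ b ∷ c ∷ [] →
    ∃[ z ] z ∈ˡ a ∷ b ∷ c ∷ [] × z ≢ x × z ≢ y
  third-corner {a} {b} {c} {x} {y} (ab , ac , bc) x∈ y∈
    with length<∣p∣⇒extra (sep (_∈ˡ? ts)) (x ∷ y ∷ [])
           (length≤∣p∣ _ (Unique₃ (Adj⇒≢ H ab) (Adj⇒≢ H ac) (Adj⇒≢ H bc)) (∈-sep⁺ (_∈ˡ? ts)))
    where ts = a ∷ b ∷ c ∷ []
  ... | z , z∈ , z∉ = z , ∈-sep⁻ (_∈ˡ? _) z∈ , z∉ ∘ here , z∉ ∘ there ∘ here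

  PendantTriple : List (Fin n) → Set
  PendantTriple ts = ∃[ a ] ∃[ b ] ∃[ c ] ts ↭ a ∷ b ∷ c ∷ [] × IsPendantTriple H a b c

  module _ {S : Subset n} {T : (a b c : Fin n) → Set} (D : Decomposition H S T) where
    open Decomposition D

    -- No piece contains the edge b′d. The vertex b′ is a corner of a triangle, hence no centre, and
    -- d is not strong. The third corner of a triangle on b′ and d would be c′, so that triangle
    -- would share the edge b′c′ with the given one.
    ¬diamond-tip : ∀ {a b c a′ b′ c′ d} → T a b c → a ∷ b ∷ c ∷ [] ↭ a′ ∷ b′ ∷ c′ ∷ [] →
      ¬ DiamondTip H a′ b′ c′ d
    ¬diamond-tip {a} {b} {c} {a′} {b′} {c′} {d} t perm (bc , bd , cd , a≢d , ¬ad , Nd) =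
      by-cover (cover bd)
      where
      d∉abc : d ∉ˡ a ∷ b ∷ c ∷ []
      d∉abc d∈ with ∈-resp-↭ perm d∈
      ... | 1st = a≢d refl
      ... | 2nd = Adj⇒≢ H bd refl
      ... | 3rd = Adj⇒≢ H cd refl
      c∈ : ∀ {x y z} → T x y z → b′ ∈ˡ x ∷ y ∷ z ∷ [] → d ∈ˡ x ∷ y ∷ z ∷ [] → c′ ∈ˡ x ∷ y ∷ z ∷ []
      c∈ t′ b∈ d∈ with third-corner (triangle t′) b∈ d∈
      ... | z , z∈ , z≢b , z≢d with Nd (triangle-adj H (triangle t′) d∈ z∈ (z≢d ∘ sym))
      ... | 1st = contradiction refl z≢b
      ... | 2nd = z∈
      by-cover : ¬ (b′ ∈ S ⊎ d ∈ S ⊎ ∃[ x ] ∃[ y ] ∃[ z ] T x y z × b′ ∈ˡ x ∷ y ∷ z ∷ [] × d ∈ˡ x ∷ y ∷ z ∷ [])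
      by-cover (inj₁ b∈S) = avoids t (∈-resp-↭ (↭-sym perm) 2nd) b∈S
      by-cover (inj₂ (inj₁ d∈S)) = [ Adj⇒≢ H bd ∘ sym , Adj⇒≢ H cd ∘ sym ]′ (strong⇒∈edge H (strong d∈S) bc
        λ dx → case Nd dx of λ { 1st → inj₁ refl ; 2nd → inj₂ refl })
      by-cover (inj₂ (inj₂ (_ , _ , _ , t′ , b∈ , d∈))) =
        d∉abc (T-unique t′ t (Adj⇒≢ H bc) b∈ (c∈ t′ b∈ d∈)
          (∈-resp-↭ (↭-sym perm) 2nd) (∈-resp-↭ (↭-sym perm) 3rd) d∈)

    all-pendant : Connected H → (∀ a b c → Dec (T a b c)) →
      (∀ a b c → T a b c → PendantTriple (a ∷ b ∷ c ∷ [])) ⊎ (H ≅ K 3 ⊎ H ≅ K 4)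
    all-pendant conn T? = ⊎-collect λ a → ⊎-collect λ b → ⊎-collect λ c → one a b c
      where
      one : ∀ a b c → (T a b c → PendantTriple (a ∷ b ∷ c ∷ [])) ⊎ (H ≅ K 3 ⊎ H ≅ K 4)
      one a b c with T? a b c
      ... | no ¬t = inj₁ λ t → contradiction t ¬t
      ... | yes t with classify H conn (triangle t) (squeezed t)
      ... | pendant perm p  = inj₁ λ _ → _ , _ , _ , perm , _ , _ , p
      ... | complete iso    = inj₂ iso
      ... | diamond perm dc = contradiction dc (¬diamond-tip t perm)

  -- What is kept of a triangle of `T` once it is known to be pendant; from here on `T` itself is no
  -- longer mentioned.
  InAvoidingPendant : Subset n → (x y : Fin n) → Set
  InAvoidingPendant S x y = ∃[ a ] ∃[ b ] ∃[ c ] IsPendantTriple H a b c ×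
    x ∈ˡ a ∷ b ∷ c ∷ [] × y ∈ˡ a ∷ b ∷ c ∷ [] × (∀ {z} → z ∈ˡ a ∷ b ∷ c ∷ [] → z ∉ S)

  pendant-cover : ∀ {S T} (D : Decomposition H S T) →
    (∀ a b c → T a b c → PendantTriple (a ∷ b ∷ c ∷ [])) →
    ∀ {x y} → Adj H x y → x ∈ S ⊎ y ∈ S ⊎ InAvoidingPendant S x y
  pendant-cover D all xy with Decomposition.cover D xy
  ... | inj₁ x∈S = inj₁ x∈S
  ... | inj₂ (inj₁ y∈S) = inj₂ (inj₁ y∈S)
  ... | inj₂ (inj₂ (a , b , c , t , x∈ , y∈)) with all a b c t
  ... | _ , _ , _ , perm , p = inj₂ (inj₂ (_ , _ , _ , p , ∈-resp-↭ perm x∈ , ∈-resp-↭ perm y∈ ,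
    Decomposition.avoids D t ∘ ∈-resp-↭ (↭-sym perm)))

  -- Here x is a neighbour of the root outside the pendant subgraph, and p, q are two adjacent
  -- non-roots. This separates H from K3, K4 and the diamond, where a vertex has at most one
  -- non-neighbour besides itself.
  pendant-non-neighbours : ∀ {a b c ns r} → Pendant H a b c ns r →
    ∃[ x ] ∃[ p ] ∃[ q ] x ∈ V H × Adj H p q × x ≢ p × ¬ Adj H x p × x ≢ q × ¬ Adj H x q
  pendant-non-neighbours {a} {b} {c} (tri t@((ab , _) , _ , _ , 3≤))
    with length<∣p∣⇒extra (N H c) (a ∷ b ∷ []) 3≤
  ... | x , cx , x∉ = x , a , b , N⊆V H cx , ab , x∉ ∘ here , ¬xa , x∉ ∘ there ∘ here , ¬xb
    where
    ¬xa : ¬ Adj H x a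
    ¬xa xa with triangle-N H t (N-sym H xa)
    ... | 1st = x∉ 2nd
    ... | 2nd = Adj⇒≢ H cx refl
    ¬xb : ¬ Adj H x b
    ¬xb xb with triangle-N H (triangle-swap H t) (N-sym H xb)
    ... | 1st = x∉ 1st
    ... | 2nd = Adj⇒≢ H cx refl
  pendant-non-neighbours (dia {a} {b} {c} {d} t@((_ , _ , bc , _ , _ , _ , ¬ad) , _ , _ , _ , 3≤))
    with length<∣p∣⇒extra (N H d) (b ∷ c ∷ []) 3≤
  ... | x , dx , x∉ = x , b , c , N⊆V H dx , bc , x∉ ∘ here , ¬xb , x∉ ∘ there ∘ here , ¬xc
    where
    ¬xb : ¬ Adj H x b
    ¬xb xb with diamond-N₂ H t (N-sym H xb)
    ... | 1st = ¬ad (N-sym H dx)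
    ... | 2nd = x∉ 2nd
    ... | 3rd = Adj⇒≢ H dx refl
    ¬xc : ¬ Adj H x c
    ¬xc xc with diamond-N₂ H (diamond-swap H t) (N-sym H xc)
    ... | 1st = ¬ad (N-sym H dx)
    ... | 2nd = x∉ 1st
    ... | 3rd = Adj⇒≢ H dx refl
  pendant-non-neighbours (k₄ {a} {b} {c} {d} t@((ab , _) , _ , _ , _ , 4≤))
    with length<∣p∣⇒extra (N H d) (a ∷ b ∷ c ∷ []) 4≤
  ... | x , dx , x∉ = x , a , b , N⊆V H dx , ab , x∉ ∘ here , ¬xa , x∉ ∘ there ∘ here , ¬xb
    where
    ¬xa : ¬ Adj H x a
    ¬xa xa with K₄-N H t (N-sym H xa)
    ... | 1st = x∉ 2nd
    ... | 2nd = x∉ 3rd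
    ... | 3rd = Adj⇒≢ H dx refl
    ¬xb : ¬ Adj H x b
    ¬xb xb with K₄-N H (K₄-swap H t) (N-sym H xb)
    ... | 1st = x∉ 1st
    ... | 2nd = x∉ 3rd
    ... | 3rd = Adj⇒≢ H dx refl

  module _ {S : Subset n} (indep : ∀ {u v} → u ∈ S → v ∈ S → ¬ Adj H u v)
    (cover : ∀ {x y} → Adj H x y → x ∈ S ⊎ y ∈ S ⊎ InAvoidingPendant S x y) where

    -- An independent set contains at most one corner and thus misses the opposite side, which must
    -- then lie in a pendant triple.
    triangle⇒pendant : ∀ {x y z} → IsTriangle H x y z → ∃[ a ] ∃[ b ] ∃[ c ] IsPendantTriple H a b c
    triangle⇒pendant (xy , xz , yz) with cover xy | cover xz | cover yz
    ... | inj₂ (inj₂ (_ , _ , _ , p , _)) | _ | _ = _ , _ , _ , p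
    ... | _ | inj₂ (inj₂ (_ , _ , _ , p , _)) | _ = _ , _ , _ , p
    ... | _ | _ | inj₂ (inj₂ (_ , _ , _ , p , _)) = _ , _ , _ , p
    ... | inj₁ x∈ | _ | inj₁ y∈ = contradiction xy (indep x∈ y∈)
    ... | inj₁ x∈ | _ | inj₂ (inj₁ z∈) = contradiction xz (indep x∈ z∈)
    ... | inj₂ (inj₁ y∈) | inj₁ x∈ | _ = contradiction xy (indep x∈ y∈)
    ... | inj₂ (inj₁ y∈) | inj₂ (inj₁ z∈) | _ = contradiction yz (indep y∈ z∈)

    -- The triangle of `Q`, carried to H, yields a pendant subgraph; its vertex with two
    -- non-neighbours, carried back to `Q`, contradicts the bound there.
    ≇-triangle : {Q : Graph m} → (∀ i → i ∈ V Q) →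
      (∃[ i ] ∃[ j ] ∃[ k ] IsTriangle Q i j k) →
      (∀ x p q → x ≢ p → ¬ Adj Q x p → x ≢ q → ¬ Adj Q x q → p ≡ q) → ¬ (H ≅ Q)
    ≇-triangle {Q = Q} V-all (i , j , k , ij , ik , jk) few iso
      with triangle⇒pendant (from-adj iso (V-all i) (V-all j) ij , from-adj iso (V-all i) (V-all k) ik ,
                             from-adj iso (V-all j) (V-all k) jk)
    ... | _ , _ , _ , _ , _ , P with pendant-non-neighbours P
    ... | x , p , q , x∈ , pq , x≢p , ¬xp , x≢q , ¬xq =
      to-≢ iso p∈ q∈ (Adj⇒≢ H pq) (few _ _ _ (to-≢ iso x∈ p∈ x≢p) (¬to-adj iso x∈ p∈ ¬xp)
        (to-≢ iso x∈ q∈ x≢q) (¬to-adj iso x∈ q∈ ¬xq))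
      where
      p∈ = N⊆V H (N-sym H pq)
      q∈ = N⊆V H pq

    ≇K₃ : ¬ (H ≅ K 3)
    ≇K₃ = ≇-triangle (λ _ → ∈⊤)
      (0F , 1F , 2F , from-yes (adj? (K 3) 0F 1F) , from-yes (adj? (K 3) 0F 2F) , from-yes (adj? (K 3) 1F 2F))
      λ x p q x≢p ¬xp → contradiction (x∉p⇒x∈∁p (x≢p ∘ sym ∘ x∈⁅y⁆⇒x≡y x)) ¬xp

    ≇K₄ : ¬ (H ≅ K 4)
    ≇K₄ = ≇-triangle (λ _ → ∈⊤)
      (0F , 1F , 2F , from-yes (adj? (K 4) 0F 1F) , from-yes (adj? (K 4) 0F 2F) , from-yes (adj? (K 4) 1F 2F))
      λ x p q x≢p ¬xp → contradiction (x∉p⇒x∈∁p (x≢p ∘ sym ∘ x∈⁅y⁆⇒x≡y x)) ¬xp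

    ≇Diamond : ¬ (H ≅ Diamond)
    ≇Diamond = ≇-triangle (λ _ → ∈⊤)
      (0F , 1F , 2F , from-yes (adj? Diamond 0F 1F) , from-yes (adj? Diamond 0F 2F) , from-yes (adj? Diamond 1F 2F))
      (from-yes (all? λ x → all? λ p → all? λ q →
        ¬? (x ≟ p) →-dec ¬? (adj? Diamond x p) →-dec ¬? (x ≟ q) →-dec ¬? (adj? Diamond x q) →-dec (p ≟ q)))

    -- Otherwise bd lies in a pendant triple. As d is not a non-root, it is the root of a pendant
    -- triangle, and then b has degree 2.
    cubic-neighbour : ∀ {b d} → ¬ NonRoot H d → d ∉ S → Adj H b d → deg H b ≡ 3 → b ∈ S
    cubic-neighbour ¬d d∉ bd db with cover bd
    ... | inj₁ b∈S = b∈S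
    ... | inj₂ (inj₁ d∈S) = contradiction d∈S d∉
    ... | inj₂ (inj₂ (_ , _ , _ , (_ , _ , p) , b∈ , d∈ , _)) with corners⊆nonRoots H p d∈
    ... | inj₁ d∈ns = contradiction (nonRoot⁺ H p d∈ns) ¬d
    ... | inj₂ refl with corner-root H p d∈ | corners⊆nonRoots H p b∈
    ... | _ | inj₂ refl = contradiction refl (Adj⇒≢ H bd)
    ... | refl , (_ , da , _) | inj₁ 1st = contradiction (trans (sym da) db) λ ()
    ... | refl , (_ , _ , da , _) | inj₁ 2nd = contradiction (trans (sym da) db) λ ()

    -- The bipartition of the pendant reduction

    module _ {F : Graph n} (ind : Induces H (λ v → ¬ NonRoot H v) F) where
      open Induces ind using () renaming (adj⁺ to F-adj⁺; adj⁻ to F-adj⁻; V⁺ to F-V⁺; V⁻ to F-V⁻)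

      W? : ∀ x → Dec (x ∈ V F × x ∉ S)
      W? x = (x ∈? V F) ×-dec ¬? (x ∈? S)

      U W : Subset n
      U = V F ∩ S
      W = sep W?

      bipartition : IsBipartition F U W
      bipartition = record
        { cover    = ⊆-antisym U∪W⊆V V⊆U∪W
        ; disjoint = λ (x , x∈) → let x∈U , x∈W = x∈p∩q⁻ U W x∈ in
            proj₂ (∈-sep⁻ W? x∈W) (p∩q⊆q (V F) S x∈U)
        ; indepU   = p∩q⊆p (V F) S , λ u∈ v∈ uv →
            indep (p∩q⊆q (V F) S u∈) (p∩q⊆q (V F) S v∈) (proj₂ (proj₂ (F-adj⁻ uv)))
        ; indepW   = proj₁ ∘ ∈-sep⁻ W? , indepW
        }
        where
        U∪W⊆V : U ∪ W ⊆ V F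
        U∪W⊆V x∈ with x∈p∪q⁻ U W x∈
        ... | inj₁ x∈U = p∩q⊆p (V F) S x∈U
        ... | inj₂ x∈W = proj₁ (∈-sep⁻ W? x∈W)
        V⊆U∪W : V F ⊆ U ∪ W
        V⊆U∪W {x} x∈ with x ∈? S
        ... | yes x∈S = x∈p∪q⁺ (inj₁ (x∈p∩q⁺ (x∈ , x∈S)))
        ... | no  x∉S = x∈p∪q⁺ (inj₂ (∈-sep⁺ W? (x∈ , x∉S)))
        -- Each edge of a pendant triple has a deleted end, so an edge of F can only be covered by
        -- `S`.
        indepW : ∀ {u v} → u ∈ W → v ∈ W → ¬ Adj F u v
        indepW u∈ v∈ uv with F-adj⁻ uv
        ... | ¬u , ¬v , a with cover a
        ... | inj₁ u∈S = proj₂ (∈-sep⁻ W? u∈) u∈S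
        ... | inj₂ (inj₁ v∈S) = proj₂ (∈-sep⁻ W? v∈) v∈S
        ... | inj₂ (inj₂ (_ , _ , _ , (_ , _ , p) , u∈p , v∈p , _))
          with one-nonRoot H p u∈p v∈p (Adj⇒≢ H a)
        ... | inj₁ u∈ns = ¬u (nonRoot⁺ H p u∈ns)
        ... | inj₂ v∈ns = ¬v (nonRoot⁺ H p v∈ns)

      root∈F : ∀ {a b c ns r} → Pendant H a b c ns r → r ∈ V F
      root∈F p = F-V⁺ (root∈V H p) (root-¬nonRoot H p)

      -- If d were outside `S`, both b and c would be in `S`, although they are adjacent.
      root∈U : ∀ {b c d} → d ∈ V F → Adj H b d → Adj H c d → Adj H b c →
        deg H b ≡ 3 → deg H c ≡ 3 → d ∈ U
      root∈U {d = d} d∈ bd cd bc db dc with d ∈? S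
      ... | yes d∈S = x∈p∩q⁺ (d∈ , d∈S)
      ... | no  d∉S = contradiction bc
        (indep (cubic-neighbour (proj₂ (F-V⁻ d∈)) d∉S bd db) (cubic-neighbour (proj₂ (F-V⁻ d∈)) d∉S cd dc))

      roots⊆U : R◇ H ∪ RK₄ H ⊆ U
      roots⊆U d∈ with x∈p∪q⁻ (R◇ H) (RK₄ H) d∈
      ... | inj₁ d∈◇ with ∈-sep⁻ (R◇? H) d∈◇
      ... | _ , _ , _ , p@((_ , _ , bc , bd , cd , _) , _ , db , dc , _) =
        root∈U (root∈F (dia p)) bd cd bc db dc
      roots⊆U d∈ | inj₂ d∈K₄ with ∈-sep⁻ (RK₄? H) d∈K₄
      ... | _ , _ , _ , p@((_ , _ , _ , bc , bd , cd) , _ , db , dc , _) =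
        root∈U (root∈F (k₄ p)) bd cd bc db dc

      -- The edge ab has to be covered. A centre a or b is adjacent to c. Otherwise ab lies in a
      -- triple that avoids `S`, and its third corner is c because a has no other neighbours.
      triangle-root∉S : ∀ {a b c} → PendantTriangle H a b c → c ∉ S
      triangle-root∉S t@((ab , ac , bc) , _) c∈ with cover ab
      ... | inj₁ a∈ = indep a∈ c∈ ac
      ... | inj₂ (inj₁ b∈) = indep b∈ c∈ bc
      ... | inj₂ (inj₂ (_ , _ , _ , (_ , _ , p) , a∈p , b∈p , avoid))
        with third-corner (pendant-triangle H p) a∈p b∈p
      ... | z , z∈ , z≢a , z≢b
        with triangle-N H t (triangle-adj H (pendant-triangle H p) a∈p z∈ (z≢a ∘ sym))
      ... | 1st = z≢b refl
      ... | 2nd = avoid z∈ c∈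

      R△⊆W : R△ H ⊆ W
      R△⊆W c∈ with ∈-sep⁻ (R△? H) c∈
      ... | _ , _ , t = ∈-sep⁺ W? (root∈F (tri t) , triangle-root∉S t)

-- Strong vertices of H remain strong in the reduction

module _ (H : Graph n) {F : Graph n} (ind : Induces H (λ v → ¬ NonRoot H v) F) {u : Fin n}
  {X : Subset n} (X≡ : X ≡ N F u ∩ R△ H) {F′ : Graph n} (ind′ : Induces F (_∉ X) F′) where

  open Induces ind using () renaming (adj⁺ to F-adj⁺; adj⁻ to F-adj⁻; V⁺ to F-V⁺)
  open Induces ind′ using () renaming (adj⁺ to F′-adj⁺; adj⁻ to F′-adj⁻; V⁺ to F′-V⁺)

  private
    X⁻ : ∀ {x} → x ∈ X → Adj F u x × x ∈ R△ H
    X⁻ x∈ = x∈p∩q⁻ (N F u) (R△ H) (subst (_ ∈_) X≡ x∈)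

    leaf : Fin n → Fin n
    leaf r with R△? H r
    ... | yes (a , _) = a
    -- A default value: `leaf` matters only on X, whose elements are all roots of pendant triangles.
    ... | no  _       = r

    leaf-pendant : ∀ {r} → r ∈ X → ∃[ b ] PendantTriangle H (leaf r) b r
    leaf-pendant {r} r∈ with R△? H r
    ... | yes (_ , b , t) = b , t
    ... | no ¬t           = contradiction (∈-sep⁻ (R△? H) (proj₂ (X⁻ r∈))) ¬t

    leaf-nonRoot : ∀ {r} → r ∈ X → NonRoot H (leaf r)
    leaf-nonRoot r∈ = nonRoot⁺ H (tri (proj₂ (leaf-pendant r∈))) 1st

    leaf-adj : ∀ {r} → r ∈ X → Adj H r (leaf r)
    leaf-adj r∈ = N-sym H (proj₁ (proj₂ (proj₁ (proj₂ (leaf-pendant r∈)))))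

    X-kept : ∀ {r} → r ∈ X → ¬ NonRoot H r
    X-kept r∈ = proj₁ (proj₂ (F-adj⁻ (proj₁ (X⁻ r∈))))

    leaf-injective : ∀ {r s} → r ∈ X → s ∈ X → leaf r ≡ leaf s → r ≡ s
    leaf-injective {r} r∈ s∈ e
      with closed H (tri (proj₂ (leaf-pendant s∈))) 1st (subst (λ a → Adj H a r) e (N-sym H (leaf-adj r∈)))
    ... | inj₁ r∈ns = contradiction (nonRoot⁺ H (tri (proj₂ (leaf-pendant s∈))) r∈ns) (X-kept r∈)
    ... | inj₂ r≡s  = r≡s

    IsLeafEdge IsBaseEdge : Fin (n * n) → Set
    IsLeafEdge e = ∃[ r ] r ∈ X × e ≡ edge r (leaf r)
    IsBaseEdge e = ∃[ a ] ∃[ b ] ∃[ c ] PendantDiamond H a b c u × e ≡ edge b c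

    isLeafEdge? : ∀ e → Dec (IsLeafEdge e)
    isLeafEdge? e = any? λ r → (r ∈? X) ×-dec (e ≟ edge r (leaf r))

    isBaseEdge? : ∀ e → Dec (IsBaseEdge e)
    isBaseEdge? e = any? λ a → any? λ b → any? λ c → pendantDiamond? H a b c u ×-dec (e ≟ edge b c)

    leafEdges baseEdges : Subset (n * n)
    leafEdges = sep isLeafEdge?
    baseEdges = sep isBaseEdge?

    leaf-matching : IsMatching H leafEdges
    leaf-matching = (λ e∈ → leafEdge∈E (∈-sep⁻ isLeafEdge? e∈)) ,
      λ e∈ f∈ → disj (∈-sep⁻ isLeafEdge? e∈) (∈-sep⁻ isLeafEdge? f∈)
      where
      leafEdge∈E : ∀ {e} → IsLeafEdge e → e ∈ E H
      leafEdge∈E (r , r∈ , refl) = edge∈E H (leaf-adj r∈)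
      disj : ∀ {e f v} → IsLeafEdge e → IsLeafEdge f → Incident v e → Incident v f → e ≡ f
      disj (r , r∈ , refl) (s , s∈ , refl) ve vf with incident⁻ r (leaf r) ve | incident⁻ s (leaf s) vf
      ... | inj₁ refl | inj₁ refl = refl
      ... | inj₁ refl | inj₂ e    = contradiction (subst (NonRoot H) (sym e) (leaf-nonRoot s∈)) (X-kept r∈)
      ... | inj₂ refl | inj₁ e    = contradiction (subst (NonRoot H) e (leaf-nonRoot r∈)) (X-kept s∈)
      ... | inj₂ refl | inj₂ e    = cong (λ t → edge t (leaf t)) (leaf-injective r∈ s∈ e)

    -- Of the three neighbours a, c, u of b, only c can be c′: a has degree 2, and u is adjacent to
    -- c′.
    other-base : ∀ {a b c a′ c′} → PendantDiamond H a b c u → PendantDiamond H a′ b c′ u → c ≡ c′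
    other-base p@(_ , da , _) ((_ , _ , bc′ , _ , c′u , _) , _ , _ , dc′ , _) with diamond-N₂ H p bc′
    ... | 1st = contradiction (trans (sym da) dc′) λ ()
    ... | 2nd = refl
    ... | 3rd = contradiction refl (Adj⇒≢ H c′u)

    base-matching : IsMatching H baseEdges
    base-matching = (λ e∈ → baseEdge∈E (∈-sep⁻ isBaseEdge? e∈)) ,
      λ e∈ f∈ → disj (∈-sep⁻ isBaseEdge? e∈) (∈-sep⁻ isBaseEdge? f∈)
      where
      baseEdge∈E : ∀ {e} → IsBaseEdge e → e ∈ E H
      baseEdge∈E (_ , _ , _ , ((_ , _ , bc , _) , _) , refl) = edge∈E H bc
      disj : ∀ {e f v} → IsBaseEdge e → IsBaseEdge f → Incident v e → Incident v f → e ≡ f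
      disj (_ , b , c , p , refl) (_ , b′ , c′ , p′ , refl) ve vf with incident⁻ b c ve | incident⁻ b′ c′ vf
      ... | inj₁ refl | inj₁ refl = cong (edge b) (other-base p p′)
      ... | inj₁ refl | inj₂ refl =
        trans (cong (edge b) (other-base p (diamond-swap H p′))) (edge-comm b b′)
      ... | inj₂ refl | inj₁ refl =
        trans (edge-comm b c) (cong (edge c) (other-base (diamond-swap H p) p′))
      ... | inj₂ refl | inj₂ refl =
        trans (edge-comm b c)
          (trans (cong (edge c) (other-base (diamond-swap H p) (diamond-swap H p′))) (edge-comm c b′))

    covers-leaf⁻ : ∀ {v} → Covers H leafEdges v → ∃[ r ] r ∈ X × (v ≡ r ⊎ v ≡ leaf r)
    covers-leaf⁻ (e , e∈ , ve) = ends (∈-sep⁻ isLeafEdge? e∈) ve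
      where
      ends : ∀ {e v} → IsLeafEdge e → Incident v e → ∃[ r ] r ∈ X × (v ≡ r ⊎ v ≡ leaf r)
      ends (r , r∈ , refl) ve = r , r∈ , incident⁻ r (leaf r) ve

    covers-base⁻ : ∀ {v} → Covers H baseEdges v → NonRoot H v × deg H v ≡ 3
    covers-base⁻ (e , e∈ , ve) = ends (∈-sep⁻ isBaseEdge? e∈) ve
      where
      ends : ∀ {e v} → IsBaseEdge e → Incident v e → NonRoot H v × deg H v ≡ 3
      ends (_ , b , c , p@(_ , _ , db , dc , _) , refl) ve with incident⁻ b c ve
      ... | inj₁ refl = nonRoot⁺ H (dia p) 2nd , db
      ... | inj₂ refl = nonRoot⁺ H (dia p) 3rd , dc

    -- The ends of base edges are non-roots of degree 3, whereas the roots in X are kept and their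
    -- leaves have degree 2.
    pendant-matching : IsMatching H (leafEdges ∪ baseEdges)
    pendant-matching = ∪-matching H leaf-matching base-matching apart
      where
      apart : ∀ {v} → Covers H leafEdges v → ¬ Covers H baseEdges v
      apart cl cb with covers-leaf⁻ cl | covers-base⁻ cb
      ... | r , r∈ , inj₁ refl | nr , _ = X-kept r∈ nr
      ... | r , r∈ , inj₂ refl | _ , d₃ =
        contradiction (trans (sym (proj₁ (proj₂ (proj₂ (leaf-pendant r∈))))) d₃) λ ()

    covers-pendant⁻ : ∀ {v} → Covers H (leafEdges ∪ baseEdges) v → v ∈ X ⊎ NonRoot H v
    covers-pendant⁻ (e , e∈ , ve) with x∈p∪q⁻ leafEdges baseEdges e∈
    ... | inj₂ e∈base = inj₂ (proj₁ (covers-base⁻ (e , e∈base , ve)))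
    ... | inj₁ e∈leaf with covers-leaf⁻ (e , e∈leaf , ve)
    ... | r , r∈ , inj₁ refl = inj₁ r∈
    ... | r , r∈ , inj₂ refl = inj₂ (leaf-nonRoot r∈)

  -- A matching M of F − X that covers the neighbours of u there extends to
  -- the neighbours of u in H by an edge r a for each r in X, where r is the root
  -- of a pendant triangle a b r, and by the edge b c of each pendant diamond
  -- a b c u.
  strong-in-reduction : ¬ NonRoot H u → u ∉ R△ H → u ∉ RK₄ H →
    IsStrongVertex H u → IsStrongVertex F′ u
  strong-in-reduction ¬u u∉△ u∉K₄ u-strong =
    forced⇒strong F′ (F′-V⁺ (F-V⁺ (proj₁ u-strong) ¬u) u∉X) forced
    where
    u∉X : u ∉ X
    u∉X u∈ = N-irrefl F (proj₁ (X⁻ u∈))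
    forced : Forced F′ u
    forced {M} (M⊆E , M-disj) nbrs = restrict (strong⇒forced H u-strong mM⁺ nbrs⁺)
      where
      M⁺ : Subset (n * n)
      M⁺ = M ∪ (leafEdges ∪ baseEdges)
      covers-M⁻ : ∀ {v} → Covers F′ M v → ¬ (v ∈ X ⊎ NonRoot H v)
      covers-M⁻ c with covers-at F′ M⊆E c
      ... | w , vw , _ with F′-adj⁻ vw
      ... | v∉X , _ , vwF = [ v∉X , proj₁ (F-adj⁻ vwF) ]′
      mM⁺ : IsMatching H M⁺
      mM⁺ = ∪-matching H ((λ e∈ → Induces.E⊆E ind (Induces.E⊆E ind′ (M⊆E e∈))) , M-disj)
        pendant-matching (λ c d → covers-M⁻ c (covers-pendant⁻ d))
      by-leaf : ∀ {x} → x ∈ X → Covers H M⁺ x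
      by-leaf {x} x∈ = edge x (leaf x) ,
        x∈p∪q⁺ (inj₂ (x∈p∪q⁺ (inj₁ (∈-sep⁺ isLeafEdge? (x , x∈ , refl))))) , incident₁ x (leaf x)
      by-base : ∀ {a b c x} → PendantDiamond H a b c u → Incident x (edge b c) → Covers H M⁺ x
      by-base {b = b} {c} p xe = edge b c ,
        x∈p∪q⁺ (inj₂ (x∈p∪q⁺ (inj₂ (∈-sep⁺ isBaseEdge? (_ , b , c , p , refl))))) , xe
      -- As u is the root of no pendant triangle and no pendant K4, a deleted neighbour of u is a
      -- middle vertex of a pendant diamond; the far tip is not adjacent to u.
      by-pendant : ∀ {a b c ns r x} → Pendant H a b c ns r → x ∈ˡ ns → r ≡ u → Adj H u x → Covers H M⁺ x
      by-pendant (tri p) _ refl _ = contradiction (∈-sep⁺ (R△? H) (_ , _ , p)) u∉△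
      by-pendant (dia p@((_ , _ , _ , _ , _ , _ , ¬ad) , _)) 1st refl ux = contradiction (N-sym H ux) ¬ad
      by-pendant (dia p) 2nd refl _ = by-base p (incident₁ _ _)
      by-pendant (dia p) 3rd refl _ = by-base p (incident₂ _ _)
      by-pendant (k₄ p) _ refl _ = contradiction (∈-sep⁺ (RK₄? H) (_ , _ , _ , p)) u∉K₄
      nbrs⁺ : ∀ {x} → Adj H u x → Covers H M⁺ x
      nbrs⁺ {x} ux with nonRoot? H x
      ... | yes nr = let _ , _ , _ , _ , _ , p , x∈ = nonRoot⁻ H nr in
        case closed H p x∈ (N-sym H ux) of λ
          { (inj₁ u∈) → contradiction (nonRoot⁺ H p u∈) ¬u
          ; (inj₂ u≡r) → by-pendant p x∈ (sym u≡r) ux }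
      ... | no ¬x with x ∈? X
      ... | yes x∈X = by-leaf x∈X
      ... | no  x∉X = covers-mono H {M} {M⁺} (p⊆p∪q _) (nbrs (F′-adj⁺ u∉X x∉X (F-adj⁺ ¬u ¬x ux)))
      -- The added edges only cover vertices of X and non-roots, so the edge at u belongs to M.
      restrict : Covers H M⁺ u → Covers F′ M u
      restrict (e , e∈ , ue) with x∈p∪q⁻ M _ e∈
      ... | inj₁ e∈M = e , e∈M , ue
      ... | inj₂ e∈p = contradiction (covers-pendant⁻ (e , e∈p , ue)) [ u∉X , ¬u ]′

-- Condition (1) with an arbitrary graph F in place of the reduction, so that both directions can be
-- proved from `Induces`.
BipartiteReduction : (H F : Graph n) → Set
BipartiteReduction H F = ¬ (H ≅ K 3) × ¬ (H ≅ K 4) × ¬ (H ≅ Diamond)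
  × Connected F
  × ∃[ U ] ∃[ W ] ( IsBipartition F U W
                  × R◇ H ∪ RK₄ H ⊆ U
                  × R△ H ⊆ W
                  × (∀ u → u ∈ U ─ RK₄ H → IsStrongVertex (F ∖ (N F u ∩ R△ H)) u) )

module _ (H : Graph n) {F : Graph n} (ind : Induces H (λ v → ¬ NonRoot H v) F) where

  decomposition⇒bipartite : Connected H → ∀ {S} → (∀ {u} → u ∈ S → IsStrongVertex H u) →
    (∀ {u v} → u ∈ S → v ∈ S → ¬ Adj H u v) →
    (∀ {x y} → Adj H x y → x ∈ S ⊎ y ∈ S ⊎ InAvoidingPendant H S x y) → BipartiteReduction H F
  decomposition⇒bipartite conn {S} strong indep cover =
    ≇K₃ H indep cover , ≇K₄ H indep cover , ≇Diamond H indep cover ,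
    reduction-connected H ind conn , U′ , W′ ,
    bipartition H indep cover ind , roots⊆U H indep cover ind , R△⊆W′ , strongU
    where
    U′ = U H indep cover ind
    W′ = W H indep cover ind
    R△⊆W′ : R△ H ⊆ W′
    R△⊆W′ = R△⊆W H indep cover ind
    strongU : ∀ u → u ∈ U′ ─ RK₄ H → IsStrongVertex (F ∖ (N F u ∩ R△ H)) u
    strongU u u∈ = strong-in-reduction H ind refl (∖-induces F (N F u ∩ R△ H))
      (proj₂ (Induces.V⁻ ind (p∩q⊆p (V F) S u∈U)))
      (λ u∈△ → proj₂ (∈-sep⁻ (W? H indep cover ind) (R△⊆W′ u∈△)) u∈S)
      (x∈p─q⇒x∉q U′ (RK₄ H) u∈) (strong u∈S)
      where
      u∈U = p─q⊆p U′ (RK₄ H) u∈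
      u∈S = p∩q⊆q (V F) S u∈U

  localizable⇒ : Connected H → Localizable (L H) → BipartiteReduction H F ⊎ (H ≅ K 3 ⊎ H ≅ K 4)
  localizable⇒ conn loc = let S , T , T? , D = localizable⇒decomposition H loc in
    case all-pendant H D conn T? of λ
      { (inj₁ all) → inj₁ (decomposition⇒bipartite conn (Decomposition.strong D) (Decomposition.indep D)
                             (pendant-cover H D all))
      ; (inj₂ iso) → inj₂ iso }

  ⇒localizable : BipartiteReduction H F ⊎ (H ≅ K 3 ⊎ H ≅ K 4) → Localizable (L H)
  ⇒localizable (inj₁ (_ , _ , _ , _ , _ , _ , bip , roots⊆U , R△⊆W , strongU)) =
    bipartition⇒localizable H ind bip roots⊆U R△⊆W strongU
  ⇒localizable (inj₂ (inj₁ iso)) = K₃⇒localizable H iso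
  ⇒localizable (inj₂ (inj₂ iso)) = K₄⇒localizable H iso

mainTheorem17 : ∀ {n : ℕ} (H : Graph n) → Connected H →
    let F = pendantReduction H in
    Localizable (L H) ⇔
    ( ( ¬ (H ≅ K 3) × ¬ (H ≅ K 4) × ¬ (H ≅ Diamond)
    × Connected F
    × ∃[ U ] ∃[ W ] ( IsBipartition F U W
    × R◇ H ∪ RK₄ H ⊆ U
    × R△ H ⊆ W
    × (∀ u → u ∈ U ─ RK₄ H → IsStrongVertex (F ∖ (N F u ∩ R△ H)) u) ) )
    ⊎ ( H ≅ K 3 ⊎ H ≅ K 4 ) )
mainTheorem17 H conn = mk⇔ (localizable⇒ H reduction conn) (⇒localizable H reduction)
  where
  reduction : Induces H (λ v → ¬ NonRoot H v) (pendantReduction H)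
  reduction = ∖-sep-induces H (nonRoot? H)
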